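{- For every integer $g\geq 5$, the number $i_g(6)$ of numerical semigroups of genus $g$ and multiplicity $6$ that are in an infinite chain is $$i_g(6)=\left\lfloor\frac{2g^2+g-16}{9}\right\rfloor-\left\lfloor\frac{(g-1)^2}{5}\right\rfloor.$$
   Context: A numerical semigroup is a subset $\Lambda\subseteq\mathbb{N}_0=\{0,1,2,\dots\}$ containing $0$, closed under addition, with finite complement in $\mathbb{N}_0$. Its genus is the cardinality of the complement. Its multiplicity is its smallest non-zero element. Its conductor $c(\Lambda)$ is the smallest $c\in\mathbb{N}_0$ with $\{\ell\in\mathbb{N}_0:\ell\ge c\}\subseteq\Lambda$. The effective generators of $\Lambda$ are the minimal generators of $\Lambda$ that are at least $c(\Lambda)$. The children of $\Lambda$ are the numerical semigroups $\Lambda\setminus\{a\}$ with $a$ an effective generator of $\Lambda$; $\Lambda$ is then the parent of each of these. An infinite chain is an infinite sequence of numerical semigroups $\Lambda_0,\Lambda_1,\Lambda_2,\dots$ such that $\Lambda_0=\mathbb{N}_0$ and $\Lambda_i$ is the parent of $\Lambda_{i+1}$ for all $i\ge 0$; a numerical semigroup is in the chain if it is one of the $\Lambda_i$. -}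

module Defs where

open import Data.List.Base using (List; length)
import Data.List.Membership.Setoid as Membership
import Data.List.Relation.Unary.Unique.Setoid as Uniqueness
open import Data.Nat.Base using (ℕ; suc; _+_; _≤_; _≥_)
open import Data.Product.Base using (∃-syntax; _×_; proj₁)
open import Function.Bundles using (_⇔_)
open import Level using (Level; 0ℓ; _⊔_) renaming (suc to lsuc)
open import Relation.Binary.Bundles using (Setoid)
import Relation.Binary.Construct.On as On
open import Relation.Binary.PropositionalEquality using (_≡_; setoid)
open import Relation.Nullary using (¬_)
open import Relation.Unary using (Pred; Decidable; _∈_; _≐_; _∖_; ∁; U; ｛_｝)
open import Relation.Unary.Relation.Binary.Equality using (≐-setoid)

private
  variable
    a ℓ p : Level

-- There are exactly n elements satisfying P, counted up to the setoid
-- equality.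
record HasCardinality (S : Setoid a ℓ) (P : Pred (Setoid.Carrier S) p)
                      (n : ℕ) : Set (a ⊔ ℓ ⊔ p) where
  field
    elements : List (Setoid.Carrier S)
    unique   : Uniqueness.Unique S elements
    complete : ∀ x → Membership._∈_ S x elements ⇔ P x
    size     : length elements ≡ n

IsLeast : Pred ℕ p → Pred ℕ p
IsLeast P n = n ∈ P × (∀ m → m ∈ P → n ≤ m)

-- Membership is required to be decidable; classically this is no restriction.
record NumericalSemigroup : Set (lsuc 0ℓ) where
  field
    Member           : Pred ℕ 0ℓ
    member?          : Decidable Member
    0-member         : 0 ∈ Member
    +-closed         : ∀ {m n} → m ∈ Member → n ∈ Member → m + n ∈ Member
    finiteComplement : ∃[ g ] HasCardinality (setoid ℕ) (∁ Member) g

  genus : ℕ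
  genus = proj₁ finiteComplement

open NumericalSemigroup public using (Member; genus)

-- Semigroups are identified when they are equal as subsets of ℕ; the proofs
-- and the chosen enumeration of the complement are ignored.
numericalSemigroups : Setoid (lsuc 0ℓ) 0ℓ
numericalSemigroups = On.setoid (≐-setoid ℕ 0ℓ) Member

IsMultiplicity : NumericalSemigroup → Pred ℕ 0ℓ
IsMultiplicity Λ = IsLeast (Member Λ ∖ ｛ 0 ｝)

IsConductor : NumericalSemigroup → Pred ℕ 0ℓ
IsConductor Λ = IsLeast (λ c → ∀ l → l ≥ c → l ∈ Member Λ)

-- The unique minimal generating set of Λ consists of the non-zero elements
-- that are not the sum of two non-zero elements of Λ.
IsMinimalGenerator : NumericalSemigroup → Pred ℕ 0ℓ
IsMinimalGenerator Λ a = a ∈ Λ* × ¬ (∃[ x ] ∃[ y ] x ∈ Λ* × y ∈ Λ* × x + y ≡ a)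
  where
  Λ* : Pred ℕ 0ℓ
  Λ* = Member Λ ∖ ｛ 0 ｝

IsEffectiveGenerator : NumericalSemigroup → Pred ℕ 0ℓ
IsEffectiveGenerator Λ a =
  IsMinimalGenerator Λ a × (∃[ c ] IsConductor Λ c × a ≥ c)

_IsParentOf_ : NumericalSemigroup → NumericalSemigroup → Set
Λ IsParentOf Λ′ =
  ∃[ a ] IsEffectiveGenerator Λ a × Member Λ′ ≐ Member Λ ∖ ｛ a ｝

record InfiniteChain : Set (lsuc 0ℓ) where
  field
    term   : ℕ → NumericalSemigroup
    start  : Member (term 0) ≐ U
    parent : ∀ i → term i IsParentOf term (suc i)

InInfiniteChain : Pred NumericalSemigroup (lsuc 0ℓ)
InInfiniteChain Λ =
  ∃[ C ] ∃[ i ] Member Λ ≐ Member (InfiniteChain.term C i)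

{-# OPTIONS --safe #-}

-- Below its conductor, a semigroup of multiplicity 6 in an infinite chain has
-- only even elements or only multiples of 3: elements below the conductor
-- persist along the chain, and 6, an odd number and a non-multiple of 3 would
-- generate all large numbers.  Conversely, if d ≥ 2, then truncations
-- M ∪ [c,∞) of a submonoid M of dℕ lie in the chain that removes the gaps of
-- M one by one.
--
-- An even such semigroup is determined by the least elements 2 + 6 x and
-- 4 + 6 y of two residue classes, subject to y ≤ 2 x and x ≤ 1 + 2 y, and by
-- the number s of odd gaps, with s + x + y = g.  Subtracting multiples of
-- (1 , 1) from (x , y) leads to the boundary rays (i , 2 i) and (1 + 2 i , i),
-- so these semigroups are counted by the pairs (i , j) with 9 i + 5 j ≤ g + 1
-- resp. 9 i + 5 j ≤ g - 2.  The semigroups that are not even are determined by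
-- the least element 3 + 6 z of a residue class, with 5 z ≤ g - 3.  The closed
-- form follows by induction from g to g + 5.

module Submission where

open import Defs
open import Data.Fin using (#_)
open import Data.Fin.Base using (Fin; toℕ) renaming (zero to fzero; suc to fsuc)
import Data.Fin.Properties as Fin
open import Data.List.Base using (List; []; _∷_; _++_; map; length; applyUpTo)
open import Data.List.Membership.Propositional using (find; lose) renaming (_∈_ to _∈ₗ_)
open import Data.List.Membership.Propositional.Properties
  using (∈-applyUpTo⁺; ∈-applyUpTo⁻; ∈-++⁺ˡ; ∈-++⁺ʳ; ∈-++⁻; ∈-map⁺; ∈-map⁻)
open import Data.List.Membership.Propositional.Properties.WithK using (unique∧set⇒bag)
import Data.List.Membership.Setoid as Membership
open import Data.List.Properties using (length-++; length-map; length-applyUpTo)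
open import Data.List.Relation.Binary.BagAndSetEquality using (∼bag⇒↭)
open import Data.List.Relation.Binary.Permutation.Propositional.Properties using (↭-length)
open import Data.List.Relation.Unary.All using (All)
import Data.List.Relation.Unary.All as All
import Data.List.Relation.Unary.All.Properties as All
open import Data.List.Relation.Unary.AllPairs using (AllPairs)
import Data.List.Relation.Unary.AllPairs as AllPairs
import Data.List.Relation.Unary.AllPairs.Properties as AllPairs
open import Data.List.Relation.Unary.Any using (here; there)
import Data.List.Relation.Unary.Any.Properties as Any
open import Data.List.Relation.Unary.Unique.Propositional using (Unique)
import Data.List.Relation.Unary.Unique.Propositional.Properties as Unique
open import Data.Nat.Base
open import Data.Nat.DivMod
open import Data.Nat.Divisibility.Core using (divides-refl)
open import Data.Nat.Properties
open import Data.Nat.Tactic.RingSolver using (solve; solve-∀)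
open import Data.Product.Base using (∃-syntax; _×_; _,_; proj₁; proj₂; uncurry)
open import Data.Sum.Base using (_⊎_; inj₁; inj₂; [_,_]′)
open import Data.Unit.Base using (tt)
open import Function.Base using (_∘_; id; case_of_)
open import Function.Bundles using (mk⇔; module Equivalence)
open import Level using (0ℓ)
open import Relation.Binary.Definitions using (tri<; tri≈; tri>)
open import Relation.Binary.PropositionalEquality
  using (_≡_; _≢_; refl; sym; trans; cong; cong₂; subst; subst₂; setoid; module ≡-Reasoning)
open import Relation.Nullary using (¬_; Dec; yes; no; contradiction)
open import Relation.Nullary.Decidable using (_⊎-dec_; map′; recompute; True; toWitness)
open import Relation.Unary using (Pred; Decidable; _∈_; _∉_; _⊆_; _≐_; ∁; _∪_)
open import Relation.Unary.Properties using (≐-sym; ≐-trans)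

-- Linear inequalities, least elements and finite cardinalities.

-- A certificate for linear arithmetic over ℕ: multiplying by 1 + k and
-- dropping the slack e and the rounding term k turns c ≤ d into a ≤ b.
linear : ∀ k e {a b c d} → c ≤ d →
         suc k * a + d + e ≡ suc k * b + c + k → a ≤ b
linear k e {a} {b} {c} {d} c≤d eq = s≤s⁻¹ (*-cancelˡ-< (suc k) a (suc b) (begin-strict
  suc k * a          ≤⟨ +-cancelʳ-≤ c _ _ (begin
    suc k * a + c      ≤⟨ +-monoʳ-≤ (suc k * a) c≤d ⟩
    suc k * a + d      ≤⟨ m≤m+n _ e ⟩
    suc k * a + d + e  ≡⟨ eq ⟩
    suc k * b + c + k  ≡⟨ solve (k ∷ b ∷ c ∷ []) ⟩
    suc k * b + k + c  ∎) ⟩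
  suc k * b + k      <⟨ +-monoʳ-< (suc k * b) (n<1+n k) ⟩
  suc k * b + suc k  ≡⟨ solve (k ∷ b ∷ []) ⟩
  suc k * suc b      ∎))
  where open ≤-Reasoning

module _ {p} {P : Pred ℕ p} (P? : Decidable P) where

  least : ∀ n → n ∈ P → ∃[ m ] IsLeast P m
  least n n∈P = search n 0 (λ ()) (subst P (sym (+-identityʳ n)) n∈P)
    where
    -- The sum `k + i` stays equal to `n`, so the known member `n` bounds the search.
    search : ∀ k i → (∀ {m} → m < i → m ∉ P) → k + i ∈ P → ∃[ m ] IsLeast P m
    search zero    i below i∈P = i , i∈P , λ m m∈P → ≮⇒≥ (λ m<i → below m<i m∈P)
    search (suc k) i below k∈P with P? i
    ... | yes i∈P = i , i∈P , λ m m∈P → ≮⇒≥ (λ m<i → below m<i m∈P)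
    ... | no  i∉P = search k (suc i) below′ (subst P (sym (+-suc k i)) k∈P)
      where
      below′ : ∀ {m} → m < suc i → m ∉ P
      below′ m<1+i with m≤n⇒m<n∨m≡n (s≤s⁻¹ m<1+i)
      ... | inj₁ m<i  = below m<i
      ... | inj₂ refl = i∉P

-- Duplicate-free lists with the same members are equal as bags, hence permutations of each other.
≐-cardinality : {P Q : Pred ℕ 0ℓ} → P ≐ Q → ∀ {m n} →
                HasCardinality (setoid ℕ) P m → HasCardinality (setoid ℕ) Q n → m ≡ n
≐-cardinality (P⊆Q , Q⊆P) cP cQ =
  trans (sym P.size) (trans (↭-length (∼bag⇒↭ (unique∧set⇒bag P.unique Q.unique
    (λ {x} → mk⇔ (Equivalence.from (Q.complete x) ∘ P⊆Q ∘ Equivalence.to (P.complete x))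
                 (Equivalence.from (P.complete x) ∘ Q⊆P ∘ Equivalence.to (Q.complete x))))))
    Q.size)
  where
  module P = HasCardinality cP
  module Q = HasCardinality cQ

-- A semigroup stores its own enumeration of the complement; this lets the genus be computed from
-- any other one.
≐-genus : ∀ Λ {P : Pred ℕ 0ℓ} {g} → Member Λ ≐ P → HasCardinality (setoid ℕ) (∁ P) g →
          genus Λ ≡ g
≐-genus Λ (Λ⊆P , P⊆Λ) =
  ≐-cardinality ((λ x∉Λ → x∉Λ ∘ P⊆Λ) , (λ x∉P → x∉P ∘ Λ⊆P))
    (proj₂ (NumericalSemigroup.finiteComplement Λ))

increasing⇒< : ∀ (f : ℕ → ℕ) → (∀ n → f n < f (suc n)) → ∀ {m n} → m < n → f m < f n
increasing⇒< f step {m} {suc n} m<1+n with m≤n⇒m<n∨m≡n (s≤s⁻¹ m<1+n)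
... | inj₁ m<n  = <-trans (increasing⇒< f step m<n) (step n)
... | inj₂ refl = step n

increasing⇒≤ : ∀ (f : ℕ → ℕ) → (∀ n → f n < f (suc n)) → ∀ {m n} → m ≤ n → f m ≤ f n
increasing⇒≤ f step m≤n with m≤n⇒m<n∨m≡n m≤n
... | inj₁ m<n  = <⇒≤ (increasing⇒< f step m<n)
... | inj₂ refl = ≤-refl

≐-HasCardinality : {P Q : Pred ℕ 0ℓ} → P ≐ Q → ∀ {n} →
                   HasCardinality (setoid ℕ) P n → HasCardinality (setoid ℕ) Q n
≐-HasCardinality (P⊆Q , Q⊆P) card = record
  { elements = elements
  ; unique   = unique
  ; complete = λ x → mk⇔ (P⊆Q ∘ Equivalence.to (complete x)) (Equivalence.from (complete x) ∘ Q⊆P)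
  ; size     = size
  }
  where open HasCardinality card

∪-HasCardinality : {P Q : Pred ℕ 0ℓ} → (∀ {x} → x ∈ P → x ∉ Q) → ∀ {m n} →
                   HasCardinality (setoid ℕ) P m → HasCardinality (setoid ℕ) Q n →
                   HasCardinality (setoid ℕ) (P ∪ Q) (m + n)
∪-HasCardinality disjoint cP cQ = record
  { elements = P.elements ++ Q.elements
  ; unique   = Unique.++⁺ P.unique Q.unique
      λ (x∈P , x∈Q) → disjoint (Equivalence.to (P.complete _) x∈P) (Equivalence.to (Q.complete _) x∈Q)
  ; complete = λ x → mk⇔
      (λ x∈ → case ∈-++⁻ P.elements x∈ of λ where
        (inj₁ x∈P) → inj₁ (Equivalence.to (P.complete x) x∈P)
        (inj₂ x∈Q) → inj₂ (Equivalence.to (Q.complete x) x∈Q))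
      λ where
        (inj₁ x∈P) → ∈-++⁺ˡ (Equivalence.from (P.complete x) x∈P)
        (inj₂ x∈Q) → ∈-++⁺ʳ P.elements (Equivalence.from (Q.complete x) x∈Q)
  ; size     = trans (length-++ P.elements) (cong₂ _+_ P.size Q.size)
  }
  where
  module P = HasCardinality cP
  module Q = HasCardinality cQ

Image< : (ℕ → ℕ) → ℕ → Pred ℕ 0ℓ
Image< f n m = ∃[ i ] i < n × m ≡ f i

Image<-HasCardinality : ∀ f → (∀ n → f n < f (suc n)) → ∀ n → HasCardinality (setoid ℕ) (Image< f n) n
Image<-HasCardinality f step n = record
  { elements = applyUpTo f n
  ; unique   = Unique.applyUpTo⁺₁ f n (λ i<j _ → <⇒≢ (increasing⇒< f step i<j))
  ; complete = λ m → mk⇔ (∈-applyUpTo⁻ f) λ { (i , i<n , refl) → ∈-applyUpTo⁺ f i<n }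
  ; size     = length-applyUpTo f n
  }

-- Infinite chains from truncated monoids.

infixr 6 _∪≥_

_∪≥_ : Pred ℕ 0ℓ → ℕ → Pred ℕ 0ℓ
(M ∪≥ c) n = n ∈ M ⊎ c ≤ n

-- Submonoids of `dℕ` with `d ≥ 2` enter only through `sparse`: one of any two consecutive numbers
-- is a gap, so the next gap is found in at most one step.
record SparseMonoid : Set₁ where
  field
    Elem     : Pred ℕ 0ℓ
    elem?    : Decidable Elem
    0-elem   : 0 ∈ Elem
    +-closed : ∀ {m n} → m ∈ Elem → n ∈ Elem → m + n ∈ Elem
    sparse   : ∀ {n} → n ∈ Elem → suc n ∉ Elem

  tail-closed : ∀ {c m n} → m ∈ Elem ∪≥ c → n ∈ Elem ∪≥ c → m + n ∈ Elem ∪≥ c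
  tail-closed (inj₁ m∈) (inj₁ n∈) = inj₁ (+-closed m∈ n∈)
  tail-closed {n = n} (inj₂ c≤m) _ = inj₂ (≤-trans c≤m (m≤m+n _ n))
  tail-closed {m = m} (inj₁ _) (inj₂ c≤n) = inj₂ (≤-trans c≤n (m≤n+m _ m))

  next : ℕ → ℕ
  next n with elem? n
  ... | yes _ = suc n
  ... | no  _ = n

  n≤next : ∀ n → n ≤ next n
  n≤next n with elem? n
  ... | yes _ = n≤1+n n
  ... | no  _ = ≤-refl

  next∉ : ∀ n → next n ∉ Elem
  next∉ n with elem? n
  ... | yes n∈ = sparse n∈
  ... | no  n∉ = n∉

  <next⇒∈ : ∀ n {m} → n ≤ m → m < next n → m ∈ Elem
  <next⇒∈ n n≤m m<next with elem? n
  ... | yes n∈ = subst Elem (≤-antisym n≤m (s≤s⁻¹ m<next)) n∈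
  ... | no  _  = contradiction m<next (≤⇒≯ n≤m)

  gap : ℕ → ℕ
  gap zero    = 1
  gap (suc j) = next (suc (gap j))

  gap∉ : ∀ j → gap j ∉ Elem
  gap∉ zero    = sparse 0-elem
  gap∉ (suc j) = next∉ _

  gap-step : ∀ j → gap j < gap (suc j)
  gap-step j = n≤next (suc (gap j))

  gap-surjective : ∀ j {n} → n ∉ Elem → n < gap j → ∃[ i ] i < j × n ≡ gap i
  gap-surjective zero    n∉ (s≤s z≤n) = contradiction 0-elem n∉
  gap-surjective (suc j) {n} n∉ n<gap with <-cmp n (gap j)
  ... | tri≈ _ n≡gap _ = j , n<1+n j , n≡gap
  ... | tri> _ _ gap<n = contradiction (<next⇒∈ (suc (gap j)) gap<n n<gap) n∉
  ... | tri< n<gapj _ _ = let i , i<j , eq = gap-surjective j n∉ n<gapj in i , m<n⇒m<1+n i<j , eq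

  term : ℕ → NumericalSemigroup
  term j = record
    { Member           = Elem ∪≥ gap j
    ; member?          = λ n → elem? n ⊎-dec gap j ≤? n
    ; 0-member         = inj₁ 0-elem
    ; +-closed         = tail-closed
    ; finiteComplement = j , ≐-HasCardinality (gap⇒∉ , ∉⇒gap) (Image<-HasCardinality gap gap-step j)
    }
    where
    gap⇒∉ : ∀ {n} → n ∈ Image< gap j → n ∉ Elem ∪≥ gap j
    gap⇒∉ (i , i<j , refl) (inj₁ gap∈)  = gap∉ i gap∈
    gap⇒∉ (i , i<j , refl) (inj₂ gapj≤) = <⇒≱ (increasing⇒< gap gap-step i<j) gapj≤

    ∉⇒gap : ∀ {n} → n ∉ Elem ∪≥ gap j → n ∈ Image< gap j
    ∉⇒gap n∉ = gap-surjective j (n∉ ∘ inj₁) (≰⇒> (n∉ ∘ inj₂))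

  -- The conductor lies just above the last removed gap and can be smaller than `gap j`, as an
  -- element of the monoid may come in between. For `j = 0` nothing has been removed and the term is
  -- all of ℕ.
  term-conductor : ∀ j → ∃[ c ] IsConductor (term j) c × gap j ≥ c
  term-conductor zero = 0 , (all , λ _ _ → z≤n) , z≤n
    where
    all : ∀ n → n ≥ 0 → n ∈ Elem ∪≥ 1
    all zero    _ = inj₁ 0-elem
    all (suc _) _ = inj₂ (s≤s z≤n)
  term-conductor (suc j) = suc (gap j) , (above , minimal) , gap-step j
    where
    above : ∀ n → n > gap j → n ∈ Elem ∪≥ gap (suc j)
    above n gap<n with gap (suc j) ≤? n
    ... | yes gap≤n = inj₂ gap≤n
    ... | no  gap≰n = inj₁ (<next⇒∈ (suc (gap j)) gap<n (≰⇒> gap≰n))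

    minimal : ∀ m → (∀ n → n ≥ m → n ∈ Elem ∪≥ gap (suc j)) → gap j < m
    minimal m above-m = ≰⇒> λ m≤gap → case above-m (gap j) m≤gap of λ where
      (inj₁ gap∈)  → gap∉ j gap∈
      (inj₂ gap≤)  → <⇒≱ (gap-step j) gap≤

  -- Both summands of a decomposition of `gap j` are smaller than `gap j`, so they lie in the
  -- monoid, and with them the gap would too.
  gap-effective : ∀ j → IsEffectiveGenerator (term j) (gap j)
  gap-effective j = ((inj₂ ≤-refl , gap≢0) , indecomposable) , term-conductor j
    where
    gap≢0 : 0 ≢ gap j
    gap≢0 0≡gap = gap∉ j (subst Elem 0≡gap 0-elem)

    summand∈ : ∀ {x y} → x ∈ Elem ∪≥ gap j → 0 ≢ y → x + y ≡ gap j → x ∈ Elem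
    summand∈ (inj₁ x∈)    _   _  = x∈
    summand∈ {x} {y} (inj₂ gap≤x) 0≢y eq = contradiction
      (subst (x <_) eq (m<m+n x (n≢0⇒n>0 (0≢y ∘ sym)))) (≤⇒≯ gap≤x)

    indecomposable : ¬ _
    indecomposable (x , y , (x∈ , 0≢x) , (y∈ , 0≢y) , eq) = gap∉ j (subst Elem eq
      (+-closed (summand∈ x∈ 0≢y eq) (summand∈ y∈ 0≢x (trans (+-comm y x) eq))))

  chain : InfiniteChain
  chain = record
    { term   = term
    ; start  = (λ _ → tt) , (λ {n} _ → proj₁ (proj₁ (proj₂ (term-conductor 0))) n z≤n)
    ; parent = λ j → gap j , gap-effective j , removed j
    }
    where
    removed : ∀ j → Member (term (suc j)) ≐ _
    removed j = to , from
      where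
      to : ∀ {n} → n ∈ Elem ∪≥ gap (suc j) → n ∈ Elem ∪≥ gap j × gap j ≢ n
      to (inj₁ n∈)   = inj₁ n∈ , λ { refl → gap∉ j n∈ }
      to (inj₂ gap≤) = inj₂ (<⇒≤ (<-≤-trans (gap-step j) gap≤)) , <⇒≢ (<-≤-trans (gap-step j) gap≤)

      from : ∀ {n} → n ∈ Elem ∪≥ gap j × gap j ≢ n → n ∈ Elem ∪≥ gap (suc j)
      from (inj₁ n∈ , _) = inj₁ n∈
      from {n} (inj₂ gap≤ , gap≢) = proj₁ (proj₁ (proj₂ (term-conductor (suc j)))) n (≤∧≢⇒< gap≤ gap≢)

  -- Raising the cut `c` to the first gap that is at least `c` changes nothing, since the numbers
  -- skipped are elements already.
  tail≐term : ∀ c → ∃[ j ] Elem ∪≥ c ≐ Member (term j)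
  tail≐term c = let j , c≤gap , between = reach c in
    j , [ inj₁ , (λ c≤n → [ inj₁ ∘ between c≤n , inj₂ ]′ (<-≤-connex _ (gap j))) ]′
      , [ inj₁ , inj₂ ∘ ≤-trans c≤gap ]′
    where
    reach : ∀ c → ∃[ j ] c ≤ gap j × (∀ {n} → c ≤ n → n < gap j → n ∈ Elem)
    reach zero = 0 , z≤n , λ { _ (s≤s z≤n) → 0-elem }
    reach (suc c) with reach c
    ... | j , c≤gap , between with m≤n⇒m<n∨m≡n c≤gap
    ...   | inj₁ c<gap = j , c<gap , between ∘ <⇒≤
    ...   | inj₂ refl  = suc j , gap-step j , <next⇒∈ (suc c)

  opaque
    -- Later arguments know a truncation only by its set of elements and its place in a chain.
    truncation : ℕ → NumericalSemigroup
    truncation c = term (proj₁ (tail≐term c))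

    truncation≐ : ∀ c → Member (truncation c) ≐ Elem ∪≥ c
    truncation≐ c = let to , from = proj₂ (tail≐term c) in from , to

    truncation-inChain : ∀ c Λ → Member Λ ≐ Member (truncation c) → InInfiniteChain Λ
    truncation-inChain c Λ Λ≐ = chain , proj₁ (tail≐term c) , Λ≐

-- Lattice point counts and the closed form.

≤/⇒*≤ : ∀ {m n} d .{{_ : NonZero d}} → m ≤ n / d → m * d ≤ n
≤/⇒*≤ {m} {n} d m≤n/d = ≤-trans (*-monoˡ-≤ d m≤n/d) (m/n*n≤m n d)

*≤⇒≤/ : ∀ {m n} d .{{_ : NonZero d}} → m * d ≤ n → m ≤ n / d
*≤⇒≤/ {m} d m*d≤n = subst (_≤ _) (m*n/n≡m m d) (/-monoˡ-≤ d m*d≤n)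

/-split : ∀ {n} d .{{_ : NonZero d}} r q → n ≡ r + q * d → n / d ≡ r / d + q
/-split d r q refl = trans (+-distrib-/-∣ʳ r (divides-refl q)) (cong (r / d +_) (m*n/n≡m q d))

opaque
  -- The pairs (i , j) ≢ (0 , 0) with 9 i + 5 j ≤ n; the recursion peels off
  -- the unit vector (0 , 1), so that the pairs with j ≡ 0 are added anew.
  pairs : ℕ → List (ℕ × ℕ)
  pairs (suc (suc (suc (suc (suc n))))) =
    map (λ (i , j) → i , suc j) ((0 , 0) ∷ pairs n) ++ applyUpTo (λ i → suc i , 0) ((5 + n) / 9)
  pairs _ = []

  ∈-pairs⁻ : ∀ n {i j} → (i , j) ∈ₗ pairs n → 1 ≤ i + j × i * 9 + j * 5 ≤ n
  ∈-pairs⁻ (suc (suc (suc (suc (suc n))))) p∈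
    with ∈-++⁻ (map (λ (i , j) → i , suc j) ((0 , 0) ∷ pairs n)) p∈
  ... | inj₂ p∈′ with ∈-applyUpTo⁻ (λ i → suc i , 0) p∈′
  ...   | i , i< , refl =
    s≤s z≤n , subst (_≤ 5 + n) (sym (+-identityʳ _)) (≤/⇒*≤ 9 i<)
  ∈-pairs⁻ (suc (suc (suc (suc (suc n))))) p∈ | inj₁ p∈′
    with ∈-map⁻ (λ (i , j) → i , suc j) p∈′
  ...   | _ , here refl , refl = s≤s z≤n , m≤m+n 5 n
  ...   | (i , j) , there ij∈ , refl =
    ≤-trans (s≤s z≤n) (m≤n+m (suc j) i) , linear 0 0 (proj₂ (∈-pairs⁻ n ij∈)) (solve (i ∷ j ∷ n ∷ []))

  no-small-pairs : ∀ {i j} → i * 9 + j * 5 ≤ 4 → ¬ 1 ≤ i + j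
  no-small-pairs {suc i} (s≤s (s≤s (s≤s (s≤s ()))))
  no-small-pairs {zero} {suc j} (s≤s (s≤s (s≤s (s≤s ()))))
  no-small-pairs {zero} {zero} _ ()

  ∈-pairs⁺ : ∀ n {i j} → 1 ≤ i + j → i * 9 + j * 5 ≤ n → (i , j) ∈ₗ pairs n
  ∈-pairs⁺ (suc (suc (suc (suc (suc n))))) {i} {suc j} _ ≤n =
    ∈-++⁺ˡ (∈-map⁺ (λ (i , j) → i , suc j) (tail i j (linear 0 0 ≤n (solve (i ∷ j ∷ n ∷ [])))))
    where
    tail : ∀ i j → i * 9 + j * 5 ≤ n → (i , j) ∈ₗ (0 , 0) ∷ pairs n
    tail zero zero _ = here refl
    tail zero (suc j) ≤n = there (∈-pairs⁺ n (s≤s z≤n) ≤n)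
    tail (suc i) j ≤n = there (∈-pairs⁺ n (s≤s z≤n) ≤n)
  ∈-pairs⁺ (suc (suc (suc (suc (suc n))))) {suc i} {zero} _ ≤n =
    ∈-++⁺ʳ (map (λ (i , j) → i , suc j) ((0 , 0) ∷ pairs n))
      (∈-applyUpTo⁺ (λ i → suc i , 0) (*≤⇒≤/ 9 (subst (_≤ 5 + n) (+-identityʳ _) ≤n)))
  ∈-pairs⁺ 0 {i} 1≤ ≤n = contradiction 1≤ (no-small-pairs {i} (≤-trans ≤n z≤n))
  ∈-pairs⁺ 1 {i} 1≤ ≤n = contradiction 1≤ (no-small-pairs {i} (≤-trans ≤n (m≤m+n 1 3)))
  ∈-pairs⁺ 2 {i} 1≤ ≤n = contradiction 1≤ (no-small-pairs {i} (≤-trans ≤n (m≤m+n 2 2)))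
  ∈-pairs⁺ 3 {i} 1≤ ≤n = contradiction 1≤ (no-small-pairs {i} (≤-trans ≤n (m≤m+n 3 1)))
  ∈-pairs⁺ 4 {i} 1≤ ≤n = contradiction 1≤ (no-small-pairs {i} ≤n)

  unique-pairs : ∀ n → Unique (pairs n)
  unique-pairs (suc (suc (suc (suc (suc n))))) = Unique.++⁺
    (Unique.map⁺ (λ { refl → refl }) (0∉pairs AllPairs.∷ unique-pairs n))
    (Unique.applyUpTo⁺₁ (λ i → suc i , 0) _ (λ { i<j _ refl → <-irrefl refl i<j }))
    disjoint
    where
    0∉pairs : All (λ p → (0 , 0) ≢ p) (pairs n)
    0∉pairs = All.tabulate λ { p∈ refl → contradiction (proj₁ (∈-pairs⁻ n p∈)) λ () }

    disjoint : ∀ {p} → ¬ (p ∈ₗ map (λ (i , j) → i , suc j) ((0 , 0) ∷ pairs n) ×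
                          p ∈ₗ applyUpTo (λ i → suc i , 0) ((5 + n) / 9))
    disjoint (p∈ , p∈′) with ∈-map⁻ (λ (i , j) → i , suc j) p∈ | ∈-applyUpTo⁻ (λ i → suc i , 0) p∈′
    ... | _ , _ , refl | _ , _ , ()
  unique-pairs 0 = AllPairs.[]
  unique-pairs 1 = AllPairs.[]
  unique-pairs 2 = AllPairs.[]
  unique-pairs 3 = AllPairs.[]
  unique-pairs 4 = AllPairs.[]

  length-pairs : ∀ n → length (pairs (5 + n)) ≡ suc (length (pairs n)) + (5 + n) / 9
  length-pairs n = trans (length-++ (map (λ (i , j) → i , suc j) ((0 , 0) ∷ pairs n)))
    (cong₂ _+_ (length-map _ ((0 , 0) ∷ pairs n)) (length-applyUpTo _ ((5 + n) / 9)))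

-- The number of semigroups of genus 5 + n.
count : ℕ → ℕ
count n = length (pairs (6 + n)) + length (pairs (3 + n)) + (2 + n) / 5

-- Each list of pairs gains the point `(0 , 1)` and the points with `j = 0`, and the last quotient
-- gains 1; this explains the 3.
count-step : ∀ n → count (5 + n) ≡ count n + 3 + (11 + n) / 9 + (8 + n) / 9
count-step n = begin
  length (pairs (11 + n)) + length (pairs (8 + n)) + (7 + n) / 5
    ≡⟨ cong₂ _+_ (cong₂ _+_ (length-pairs (6 + n)) (length-pairs (3 + n)))
                 (/-split 5 (2 + n) 1 (+-comm 5 (2 + n))) ⟩
  suc (length (pairs (6 + n))) + (11 + n) / 9 + (suc (length (pairs (3 + n))) + (8 + n) / 9)
    + ((2 + n) / 5 + 1)
    ≡⟨ rearrange (length (pairs (6 + n))) (length (pairs (3 + n))) ((2 + n) / 5)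
         ((11 + n) / 9) ((8 + n) / 9) ⟩
  count n + 3 + (11 + n) / 9 + (8 + n) / 9 ∎
  where
  open ≡-Reasoning
  rearrange : ∀ a b c d e → suc a + d + (suc b + e) + (c + 1) ≡ a + b + c + 3 + d + e
  rearrange = solve-∀

-- The quotient (2 g² + g - 16) / 9 for g = 5 + n.
ninth : ℕ → ℕ
ninth n = (n * n * 2 + n * 21 + 39) / 9

-- Writing `n = r + k * 9` moves `k` out of all quotients. What remains is an equation in the
-- residue `r`, checked for its nine values.
ninth-step : ∀ n → ninth (n + 5) ≡ ninth n + 3 + (n + 11) / 9 + (n + 8) / 9 + (n * 2 + 13)
ninth-step n with n divMod 9
... | result k ρ refl = begin
  ninth (r + k * 9 + 5)
    ≡⟨ /-split 9 (r * r * 2 + r * 41 + 194) (A + k * 41) (expand₁ r k) ⟩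
  (r * r * 2 + r * 41 + 194) / 9 + (A + k * 41)
    ≡⟨ cong (_+ (A + k * 41)) (residues ρ) ⟩
  ninth r + 3 + (r + 11) / 9 + (r + 8) / 9 + (r * 2 + 13) + (A + k * 41)
    ≡⟨ rearrange (ninth r) ((r + 11) / 9) ((r + 8) / 9) r k A ⟩
  (ninth r + (A + k * 21)) + 3 + ((r + 11) / 9 + k) + ((r + 8) / 9 + k) + ((r + k * 9) * 2 + 13)
    ≡⟨ cong (_+ ((r + k * 9) * 2 + 13)) (cong₂ _+_ (cong₂ _+_ (cong (_+ 3)
         (/-split 9 (r * r * 2 + r * 21 + 39) (A + k * 21) (expand₂ r k)))
         (/-split 9 (r + 11) k (swap r k 11))) (/-split 9 (r + 8) k (swap r k 8))) ⟨
  ninth (r + k * 9) + 3 + (r + k * 9 + 11) / 9 + (r + k * 9 + 8) / 9 + ((r + k * 9) * 2 + 13) ∎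
  where
  open ≡-Reasoning
  r = toℕ ρ
  A = k * k * 18 + r * k * 4

  expand₁ : ∀ r k → (r + k * 9 + 5) * (r + k * 9 + 5) * 2 + (r + k * 9 + 5) * 21 + 39 ≡
    r * r * 2 + r * 41 + 194 + (k * k * 18 + r * k * 4 + k * 41) * 9
  expand₁ = solve-∀

  expand₂ : ∀ r k → (r + k * 9) * (r + k * 9) * 2 + (r + k * 9) * 21 + 39 ≡
    r * r * 2 + r * 21 + 39 + (k * k * 18 + r * k * 4 + k * 21) * 9
  expand₂ = solve-∀

  swap : ∀ r k m → r + k * 9 + m ≡ r + m + k * 9
  swap = solve-∀

  rearrange : ∀ a b c r k A → a + 3 + b + c + (r * 2 + 13) + (A + k * 41) ≡
    (a + (A + k * 21)) + 3 + (b + k) + (c + k) + ((r + k * 9) * 2 + 13)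
  rearrange = solve-∀

  residues : ∀ (ρ : Fin 9) → let r = toℕ ρ in (r * r * 2 + r * 41 + 194) / 9 ≡
    ninth r + 3 + (r + 11) / 9 + (r + 8) / 9 + (r * 2 + 13)
  residues = toWitness {a? = Fin.all? λ ρ → _ ≟ _} _

opaque
  unfolding pairs

  count-base : ∀ (ρ : Fin 5) → let n = toℕ ρ in count n + (n + 4) * (n + 4) / 5 ≡ ninth n
  count-base = toWitness {a? = Fin.all? λ ρ → _ ≟ _} _

-- Stated as a sum, so that truncated subtraction appears only in the final formula. In a step of 5
-- the square grows by `(n * 2 + 13) * 5`, so its quotient grows by the same `n * 2 + 13` as in
-- `ninth-step`.
count-identity : ∀ n → count n + (n + 4) * (n + 4) / 5 ≡ ninth n
count-identity (suc (suc (suc (suc (suc n))))) = begin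
  count (5 + n) + (5 + n + 4) * (5 + n + 4) / 5
    ≡⟨ cong₂ _+_ (count-step n) (trans (cong (λ m → (m + 4) * (m + 4) / 5) (+-comm 5 n))
         (/-split 5 ((n + 4) * (n + 4)) (n * 2 + 13) (expand n))) ⟩
  count n + 3 + (11 + n) / 9 + (8 + n) / 9 + ((n + 4) * (n + 4) / 5 + (n * 2 + 13))
    ≡⟨ rearrange (count n) ((11 + n) / 9) ((8 + n) / 9) ((n + 4) * (n + 4) / 5) (n * 2 + 13) ⟩
  count n + (n + 4) * (n + 4) / 5 + 3 + (11 + n) / 9 + (8 + n) / 9 + (n * 2 + 13)
    ≡⟨ cong₂ (λ a b → count n + (n + 4) * (n + 4) / 5 + 3 + a / 9 + b / 9 + (n * 2 + 13)) (+-comm 11 n) (+-comm 8 n) ⟩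
  count n + (n + 4) * (n + 4) / 5 + 3 + (n + 11) / 9 + (n + 8) / 9 + (n * 2 + 13)
    ≡⟨ cong (λ m → m + 3 + (n + 11) / 9 + (n + 8) / 9 + (n * 2 + 13)) (count-identity n) ⟩
  ninth n + 3 + (n + 11) / 9 + (n + 8) / 9 + (n * 2 + 13)
    ≡⟨ ninth-step n ⟨
  ninth (n + 5)
    ≡⟨ cong ninth (+-comm n 5) ⟩
  ninth (5 + n) ∎
  where
  open ≡-Reasoning
  rearrange : ∀ a b c d e → a + 3 + b + c + (d + e) ≡ a + d + 3 + b + c + e
  rearrange = solve-∀

  expand : ∀ n → (n + 5 + 4) * (n + 5 + 4) ≡ (n + 4) * (n + 4) + (n * 2 + 13) * 5
  expand = solve-∀
count-identity 0 = count-base (# 0)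
count-identity 1 = count-base (# 1)
count-identity 2 = count-base (# 2)
count-identity 3 = count-base (# 3)
count-identity 4 = count-base (# 4)

count-formula : ∀ n → count n ≡ (2 * (5 + n) ^ 2 + (5 + n) ∸ 16) / 9 ∸ (4 + n) ^ 2 / 5
count-formula n = begin
  count n
    ≡⟨ m+n∸n≡m (count n) ((n + 4) * (n + 4) / 5) ⟨
  count n + (n + 4) * (n + 4) / 5 ∸ (n + 4) * (n + 4) / 5
    ≡⟨ cong (_∸ (n + 4) * (n + 4) / 5) (count-identity n) ⟩
  ninth n ∸ (n + 4) * (n + 4) / 5
    ≡⟨ cong (λ m → m / 9 ∸ (n + 4) * (n + 4) / 5) (m+n∸n≡m (n * n * 2 + n * 21 + 39) 16) ⟨
  (n * n * 2 + n * 21 + 39 + 16 ∸ 16) / 9 ∸ (n + 4) * (n + 4) / 5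
    ≡⟨ cong₂ (λ a b → (a ∸ 16) / 9 ∸ b / 5) (expand₁ n) (expand₂ n) ⟩
  (2 * (n + 5) ^ 2 + (n + 5) ∸ 16) / 9 ∸ (n + 4) ^ 2 / 5
    ≡⟨ cong₂ (λ a b → (2 * a ^ 2 + a ∸ 16) / 9 ∸ b ^ 2 / 5) (+-comm n 5) (+-comm n 4) ⟩
  (2 * (5 + n) ^ 2 + (5 + n) ∸ 16) / 9 ∸ (4 + n) ^ 2 / 5 ∎
  where
  open ≡-Reasoning
  expand₁ : ∀ n → n * n * 2 + n * 21 + 39 + 16 ≡ 2 * ((n + 5) * ((n + 5) * 1)) + (n + 5)
  expand₁ = solve-∀

  expand₂ : ∀ n → (n + 4) * (n + 4) ≡ (n + 4) * ((n + 4) * 1)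
  expand₂ = solve-∀

-- Odd numbers, non-multiples of 3 and generation modulo 6.

odd : ℕ → ℕ
odd k = 1 + k * 2

-- Numbered from 0, like `odd`, so that an index counts the smaller terms: exactly `t` non-multiples
-- of 3 lie below `nonTriple t`.
nonTriple : ℕ → ℕ
nonTriple 0             = 1
nonTriple 1             = 2
nonTriple (suc (suc k)) = 3 + nonTriple k

odd-period : ∀ k q → odd (k + q * 3) ≡ odd k + q * 6
odd-period k q = cong suc (expand k q)
  where
  expand : ∀ k q → (k + q * 3) * 2 ≡ k * 2 + q * 6
  expand = solve-∀

nonTriple-period : ∀ k q → nonTriple (k + q * 4) ≡ nonTriple k + q * 6
nonTriple-period k zero = trans (cong nonTriple (+-identityʳ k)) (sym (+-identityʳ _))
nonTriple-period k (suc q) = begin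
  nonTriple (k + (4 + q * 4))    ≡⟨ cong nonTriple (swap k 4 (q * 4)) ⟩
  6 + nonTriple (k + q * 4)      ≡⟨ cong (6 +_) (nonTriple-period k q) ⟩
  6 + (nonTriple k + q * 6)      ≡⟨ swap (nonTriple k) 6 (q * 6) ⟨
  nonTriple k + (6 + q * 6)      ∎
  where
  open ≡-Reasoning
  swap : ∀ a b c → a + (b + c) ≡ b + (a + c)
  swap = solve-∀

odd-step : ∀ k → odd k < odd (suc k)
odd-step k = <-trans (n<1+n _) (n<1+n _)

nonTriple-step : ∀ k → nonTriple k < nonTriple (suc k)
nonTriple-step zero          = ≤-refl
nonTriple-step (suc zero)    = s≤s (s≤s (s≤s z≤n))
nonTriple-step (suc (suc k)) = +-monoʳ-< 3 (nonTriple-step k)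

≤nonTriple : ∀ k → k ≤ nonTriple k
≤nonTriple zero    = z≤n
≤nonTriple (suc k) = ≤-<-trans (≤nonTriple k) (nonTriple-step k)

nonTriple-mod-3 : ∀ k → ∃[ m ] (nonTriple k ≡ 1 + m * 3 ⊎ nonTriple k ≡ 2 + m * 3)
nonTriple-mod-3 0 = 0 , inj₁ refl
nonTriple-mod-3 1 = 0 , inj₂ refl
nonTriple-mod-3 (suc (suc k)) with nonTriple-mod-3 k
... | m , inj₁ eq = suc m , inj₁ (cong (3 +_) eq)
... | m , inj₂ eq = suc m , inj₂ (cong (3 +_) eq)

module _ (Λ : NumericalSemigroup) where
  open NumericalSemigroup Λ using (0-member; +-closed)

  *-closed : ∀ k {m} → m ∈ Member Λ → k * m ∈ Member Λ
  *-closed zero    _  = 0-member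
  *-closed (suc k) m∈ = +-closed m∈ (*-closed k m∈)

  module _ (6∈ : 6 ∈ Member Λ) where

    multiple-of-6 : ∀ q → q * 6 ∈ Member Λ
    multiple-of-6 q = *-closed q 6∈

    same-residue : ∀ r {q q′} → q ≤ q′ → r + q * 6 ∈ Member Λ → r + q′ * 6 ∈ Member Λ
    same-residue r {q} q≤q′ r+q∈ with p , refl ← m≤n⇒∃[o]m+o≡n q≤q′ =
      subst (Member Λ) (regroup r q p) (+-closed r+q∈ (multiple-of-6 p))
      where
      regroup : ∀ r q p → r + q * 6 + p * 6 ≡ r + (q + p) * 6
      regroup = solve-∀

    -- The multiple `r * (1 + w * 6)` has residue `r`, and adding sixes reaches everything above it
    -- in its class. The bound `5 * w * 6` serves the worst residue 5.
    above-unit : ∀ w → 1 + w * 6 ∈ Member Λ → ∀ n → 5 * w * 6 ≤ n → n ∈ Member Λ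
    above-unit w unit∈ n large = subst (Member Λ) (sym (m≡m%n+[m/n]*n n 6))
      (same-residue (n % 6) rw≤ (subst (Member Λ) (regroup (n % 6) w) (*-closed (n % 6) unit∈)))
      where
      rw≤ : n % 6 * w ≤ n / 6
      rw≤ = ≤-trans (*-monoˡ-≤ w (s≤s⁻¹ (m%n<n n 6))) (*≤⇒≤/ 6 large)

      regroup : ∀ r w → r * (1 + w * 6) ≡ r + r * w * 6
      regroup = solve-∀

-- Some combination of an odd number and a non-multiple of 3 is 1 modulo 6.
unit-mod-6 : ∀ k t → ∃[ w ] ∀ Λ → odd k ∈ Member Λ → nonTriple t ∈ Member Λ → 1 + w * 6 ∈ Member Λ
unit-mod-6 k t with nonTriple-mod-3 t
-- Three times an odd number is 3 modulo 6, while `4 * (1 + m * 3)` and `2 * (2 + m * 3)` are both 4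
-- modulo 6.
... | m , inj₁ eq = 1 + k + m * 2 , λ Λ odd∈ nonTriple∈ → subst (Member Λ) (expand k m)
  (NumericalSemigroup.+-closed Λ (*-closed Λ 3 odd∈)
    (*-closed Λ 4 (subst (Member Λ) eq nonTriple∈)))
  where
  expand : ∀ k m → 3 * (1 + k * 2) + 4 * (1 + m * 3) ≡ 1 + (1 + k + m * 2) * 6
  expand = solve-∀
... | m , inj₂ eq = 1 + k + m , λ Λ odd∈ nonTriple∈ → subst (Member Λ) (expand k m)
  (NumericalSemigroup.+-closed Λ (*-closed Λ 3 odd∈)
    (*-closed Λ 2 (subst (Member Λ) eq nonTriple∈)))
  where
  expand : ∀ k m → 3 * (1 + k * 2) + 2 * (2 + m * 3) ≡ 1 + (1 + k + m) * 6
  expand = solve-∀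

-- Persistence below the conductor along a chain.

module _ (C : InfiniteChain) where
  open InfiniteChain C

  removed : ℕ → ℕ
  removed i = proj₁ (parent i)

  conductor : ℕ → ℕ
  conductor i = proj₁ (proj₂ (proj₁ (proj₂ (parent i))))

  above-conductor : ∀ i n → conductor i ≤ n → n ∈ Member (term i)
  above-conductor i = proj₁ (proj₁ (proj₂ (proj₂ (proj₁ (proj₂ (parent i))))))

  conductor≤removed : ∀ i → conductor i ≤ removed i
  conductor≤removed i = proj₂ (proj₂ (proj₂ (proj₁ (proj₂ (parent i)))))

  removed∉ : ∀ i → removed i ∉ Member (term (suc i))
  removed∉ i removed∈ = proj₂ (proj₁ (proj₂ (proj₂ (parent i))) removed∈) refl

  kept∈ : ∀ i {n} → n < conductor i → n ∈ Member (term i) → n ∈ Member (term (suc i))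
  kept∈ i n<c n∈ = proj₂ (proj₂ (proj₂ (parent i)))
    (n∈ , λ { refl → <⇒≱ n<c (conductor≤removed i) })

  -- The removed number is at least the old conductor and is missing from the next term, so the new
  -- conductor exceeds it.
  conductor-step : ∀ i → conductor i < conductor (suc i)
  conductor-step i = ≤-<-trans (conductor≤removed i)
    (≰⇒> (removed∉ i ∘ above-conductor (suc i) (removed i)))

  persistent : ∀ i {n} → n < conductor i → n ∈ Member (term i) → ∀ k → n ∈ Member (term (k + i))
  persistent i n<c n∈ zero    = n∈
  persistent i n<c n∈ (suc k) = kept∈ (k + i)
    (<-≤-trans n<c (increasing⇒≤ conductor conductor-step (m≤n+m i k)))
    (persistent i n<c n∈ k)

  removed-large : ∀ i → i ≤ removed i
  removed-large i = ≤-trans (large i) (conductor≤removed i)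
    where
    large : ∀ i → i ≤ conductor i
    large zero    = z≤n
    large (suc i) = ≤-<-trans (large i) (conductor-step i)

  -- Everything below the conductor stays in the chain forever, so it cannot
  -- generate all large numbers.
  chain-dichotomy : ∀ i k t → 6 ≤ odd k → 6 ∈ Member (term i) →
                    odd k ∈ Member (term i) → nonTriple t ∈ Member (term i) →
                    conductor i ≤ odd k ⊎ conductor i ≤ nonTriple t
  chain-dichotomy i k t 6≤odd 6∈ odd∈ nonTriple∈
    with conductor i ≤? odd k | conductor i ≤? nonTriple t
  ... | yes c≤odd | _ = inj₁ c≤odd
  ... | no  _     | yes c≤nonTriple = inj₂ c≤nonTriple
  ... | no  c≰odd | no  c≰nonTriple = contradiction
    -- By `6≤odd`, 6 is below the conductor as well and persists.
    (above-unit later (stays (≤-<-trans 6≤odd (≰⇒> c≰odd)) 6∈) w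
      (unit∈ later (stays (≰⇒> c≰odd) odd∈) (stays (≰⇒> c≰nonTriple) nonTriple∈))
      (removed (N + i)) (≤-trans (m≤m+n N i) (removed-large (N + i))))
    (removed∉ (N + i))
    where
    w = proj₁ (unit-mod-6 k t)
    unit∈ = proj₂ (unit-mod-6 k t)
    -- The term `later` depends on `w`, so `w` has to serve all semigroups at once. The number
    -- removed just before `later` is at least `N`, hence would be an element of `later`.
    N = 5 * w * 6
    later = term (suc N + i)

    stays : ∀ {n} → n < conductor i → n ∈ Member (term i) → n ∈ Member later
    stays n<c n∈ = persistent i n<c n∈ (suc N)

-- Sets described by residue classes modulo 6.

residue-step : ∀ r q → r + q * 6 < r + suc q * 6
residue-step r q = +-monoʳ-< r (m≤n+m (suc (q * 6)) 5)

residue-+ : ∀ r r′ q q′ → r + q * 6 + (r′ + q′ * 6) ≡ r + r′ + (q + q′) * 6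
residue-+ = solve-∀

residue-unique : ∀ {r r′} q q′ → r < 6 → r′ < 6 → r + q * 6 ≡ r′ + q′ * 6 → r ≡ r′
residue-unique {r} {r′} q q′ r<6 r′<6 eq = begin
  r                  ≡⟨ m<n⇒m%n≡m r<6 ⟨
  r % 6              ≡⟨ [m+kn]%n≡m%n r q 6 ⟨
  (r + q * 6) % 6    ≡⟨ cong (_% 6) eq ⟩
  (r′ + q′ * 6) % 6  ≡⟨ [m+kn]%n≡m%n r′ q′ 6 ⟩
  r′ % 6             ≡⟨ m<n⇒m%n≡m r′<6 ⟩
  r′                 ∎
  where open ≡-Reasoning

-- For `r < 6`, `P r q` stands for membership of `r + q * 6`. Giving `P` as a data type lets absurd
-- patterns refute membership in the empty classes.
record ResiduePattern : Set₁ where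
  field
    P            : ℕ → ℕ → Set
    P?           : ∀ r q → Dec (P r q)
    zero-residue : ∀ {q} → P 0 q

  Elem : Pred ℕ 0ℓ
  Elem n = P (n % 6) (n / 6)

  elem? : Decidable Elem
  elem? n = P? (n % 6) (n / 6)

  private
    %-/ : ∀ r q → r < 6 → P ((r + q * 6) % 6) ((r + q * 6) / 6) ≡ P r q
    %-/ r q r<6 = cong₂ P (trans ([m+kn]%n≡m%n r q 6) (m<n⇒m%n≡m r<6))
      (trans (/-split 6 r q refl) (cong (_+ q) (m<n⇒m/n≡0 r<6)))

  elem⁺ : ∀ {n} r q → r < 6 → P r q → n ≡ r + q * 6 → n ∈ Elem
  elem⁺ r q r<6 p refl = subst id (sym (%-/ r q r<6)) p

  elem⁻ : ∀ {n} r q → r < 6 → n ∈ Elem → n ≡ r + q * 6 → P r q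
  elem⁻ r q r<6 n∈ refl = subst id (%-/ r q r<6) n∈

  elem-view : ∀ n → n ∈ Elem → ∃[ r ] ∃[ q ] n ≡ r + q * 6 × P r q
  elem-view n n∈ = n % 6 , n / 6 , m≡m%n+[m/n]*n n 6 , n∈

  -- A non-zero number below 6 has quotient 0 and non-zero residue; the pattern excludes these and
  -- the tail starts at 6 or later.
  multiplicity : (∀ {r} → ¬ P (suc r) 0) → ∀ Λ {c} →
                 Member Λ ≐ Elem ∪≥ c → 6 ≤ c → IsMultiplicity Λ 6
  multiplicity ¬P-0 Λ (to , from) 6≤c = (from (inj₁ (elem⁺ 0 1 (s≤s z≤n) zero-residue refl)) , λ ()) ,
    λ m (m∈ , 0≢m) → [ large 0≢m , ≤-trans 6≤c ]′ (to m∈)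
    where
    large : ∀ {m} → 0 ≢ m → m ∈ Elem → 6 ≤ m
    large {m} 0≢m m∈ with elem-view m m∈
    ... | zero  , zero  , refl , _ = contradiction refl 0≢m
    ... | suc r , zero  , _    , p = contradiction p ¬P-0
    ... | r     , suc q , refl , _ = ≤-trans (m≤m+n 6 (q * 6)) (m≤n+m (6 + q * 6) r)

below-6 : ∀ r {r<6 : True (r <? 6)} → r < 6
below-6 r {r<6} = toWitness r<6

-- `x` and `y` are the Kunz coordinates of the classes 2 and 4, that is, their numbers of gaps.
data EvenPattern (x y : ℕ) : ℕ → ℕ → Set where
  zero : ∀ {q} → EvenPattern x y 0 q
  two  : ∀ {q} → x ≤ q → EvenPattern x y 2 q
  four : ∀ {q} → y ≤ q → EvenPattern x y 4 q

evenPattern? : ∀ x y r q → Dec (EvenPattern x y r q)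
evenPattern? x y 0 q = yes zero
evenPattern? x y 1 q = no λ ()
evenPattern? x y 2 q = map′ two (λ { (two x≤q) → x≤q }) (x ≤? q)
evenPattern? x y 3 q = no λ ()
evenPattern? x y 4 q = map′ four (λ { (four y≤q) → y≤q }) (y ≤? q)
evenPattern? x y (suc (suc (suc (suc (suc r))))) q = no λ ()

data TriplePattern (z : ℕ) : ℕ → ℕ → Set where
  zero  : ∀ {q} → TriplePattern z 0 q
  three : ∀ {q} → z ≤ q → TriplePattern z 3 q

triplePattern? : ∀ z r q → Dec (TriplePattern z r q)
triplePattern? z 0 q = yes zero
triplePattern? z 1 q = no λ ()
triplePattern? z 2 q = no λ ()
triplePattern? z 3 q = map′ three (λ { (three z≤q) → z≤q }) (z ≤? q)
triplePattern? z (suc (suc (suc (suc r)))) q = no λ ()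

evenPattern : ℕ → ℕ → ResiduePattern
evenPattern x y = record
  { P = EvenPattern x y ; P? = evenPattern? x y ; zero-residue = zero }

triplePattern : ℕ → ResiduePattern
triplePattern z = record
  { P = TriplePattern z ; P? = triplePattern? z ; zero-residue = zero }

module Even (x y : ℕ) = ResiduePattern (evenPattern x y)
module Triple (z : ℕ) = ResiduePattern (triplePattern z)

odd∉ : ∀ x y k → odd k ∉ Even.Elem x y
odd∉ x y k odd∈ with k divMod 3
... | result q fzero refl with () ← Even.elem⁻ x y 1 q (below-6 1) odd∈ (odd-period 0 q)
... | result q (fsuc fzero) refl with () ← Even.elem⁻ x y 3 q (below-6 3) odd∈ (odd-period 1 q)
... | result q (fsuc (fsuc fzero)) refl with () ← Even.elem⁻ x y 5 q (below-6 5) odd∈ (odd-period 2 q)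

nonTriple∉ : ∀ z k → nonTriple k ∉ Triple.Elem z
nonTriple∉ z k nonTriple∈ with k divMod 4
... | result q fzero refl
  with () ← Triple.elem⁻ z 1 q (below-6 1) nonTriple∈ (nonTriple-period 0 q)
... | result q (fsuc fzero) refl
  with () ← Triple.elem⁻ z 2 q (below-6 2) nonTriple∈ (nonTriple-period 1 q)
... | result q (fsuc (fsuc fzero)) refl
  with () ← Triple.elem⁻ z 4 q (below-6 4) nonTriple∈ (nonTriple-period 2 q)
... | result q (fsuc (fsuc (fsuc fzero))) refl
  with () ← Triple.elem⁻ z 5 q (below-6 5) nonTriple∈ (nonTriple-period 3 q)

-- The even monoids and the monoids of multiples of 3.

-- Irrelevant fields make seeds with the same x and y equal.
record EvenSeed : Set where
  constructor seed
  field
    x y     : ℕ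
    .y≤2x   : y ≤ x * 2
    .x≤1+2y : x ≤ 1 + y * 2

-- The inequalities of a seed are what closure needs: residues 2 and 2 add up to 4 without a carry,
-- residues 4 and 4 to 2 with carry 1, and residues 2 and 4 to the full class 0.
evenMonoid : EvenSeed → SparseMonoid
evenMonoid (seed x y y≤ x≤) = record
  { Elem     = Elem
  ; elem?    = elem?
  ; 0-elem   = zero
  ; +-closed = λ {m} {n} m∈ n∈ →
      subst₂ (λ m n → m + n ∈ Elem) (sym (m≡m%n+[m/n]*n m 6)) (sym (m≡m%n+[m/n]*n n 6)) (sum m∈ n∈)
  ; sparse   = λ {n} n∈ → successor (elem-view n n∈)
  }
  where
  open Even x y

  y≤p+q : ∀ {p q} → x ≤ p → x ≤ q → y ≤ p + q
  -- Deciding the inequality regains a relevant proof from the irrelevant field.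
  y≤p+q {p} {q} x≤p x≤q = ≤-trans (recompute (y ≤? x * 2) y≤)
    (linear 0 0 (+-mono-≤ x≤p x≤q) (solve (x ∷ p ∷ q ∷ [])))

  x≤1+p+q : ∀ {p q} → y ≤ p → y ≤ q → x ≤ 1 + p + q
  x≤1+p+q {p} {q} y≤p y≤q = ≤-trans (recompute (x ≤? 1 + y * 2) x≤)
    (linear 0 0 (+-mono-≤ y≤p y≤q) (solve (y ∷ p ∷ q ∷ [])))

  sum : ∀ {r q r′ q′} → P r q → P r′ q′ → r + q * 6 + (r′ + q′ * 6) ∈ Elem
  sum {q = q} {q′ = q′} zero zero =
    elem⁺ 0 (q + q′) (below-6 0) zero (residue-+ 0 0 q q′)
  sum {q = q} {q′ = q′} zero (two x≤q′) =
    elem⁺ 2 (q + q′) (below-6 2) (two (m≤n⇒m≤o+n q x≤q′)) (residue-+ 0 2 q q′)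
  sum {q = q} {q′ = q′} zero (four y≤q′) =
    elem⁺ 4 (q + q′) (below-6 4) (four (m≤n⇒m≤o+n q y≤q′)) (residue-+ 0 4 q q′)
  sum {q = q} {q′ = q′} (two x≤q) zero =
    elem⁺ 2 (q + q′) (below-6 2) (two (m≤n⇒m≤n+o q′ x≤q)) (residue-+ 2 0 q q′)
  sum {q = q} {q′ = q′} (two x≤q) (two x≤q′) =
    elem⁺ 4 (q + q′) (below-6 4) (four (y≤p+q x≤q x≤q′)) (residue-+ 2 2 q q′)
  sum {q = q} {q′ = q′} (two _) (four _) =
    elem⁺ 0 (1 + q + q′) (below-6 0) zero (residue-+ 2 4 q q′)
  sum {q = q} {q′ = q′} (four y≤q) zero =
    elem⁺ 4 (q + q′) (below-6 4) (four (m≤n⇒m≤n+o q′ y≤q)) (residue-+ 4 0 q q′)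
  sum {q = q} {q′ = q′} (four _) (two _) =
    elem⁺ 0 (1 + q + q′) (below-6 0) zero (residue-+ 4 2 q q′)
  sum {q = q} {q′ = q′} (four y≤q) (four y≤q′) =
    elem⁺ 2 (1 + q + q′) (below-6 2) (two (x≤1+p+q y≤q y≤q′)) (residue-+ 4 4 q q′)

  successor : ∀ {n} → ∃[ r ] ∃[ q ] n ≡ r + q * 6 × P r q → suc n ∉ Elem
  successor (0 , q , refl , zero)   1+n∈ with () ← elem⁻ 1 q (below-6 1) 1+n∈ refl
  successor (2 , q , refl , two _)  1+n∈ with () ← elem⁻ 3 q (below-6 3) 1+n∈ refl
  successor (4 , q , refl , four _) 1+n∈ with () ← elem⁻ 5 q (below-6 5) 1+n∈ refl

tripleMonoid : ℕ → SparseMonoid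
tripleMonoid z = record
  { Elem     = Elem
  ; elem?    = elem?
  ; 0-elem   = zero
  ; +-closed = λ {m} {n} m∈ n∈ →
      subst₂ (λ m n → m + n ∈ Elem) (sym (m≡m%n+[m/n]*n m 6)) (sym (m≡m%n+[m/n]*n n 6)) (sum m∈ n∈)
  ; sparse   = λ {n} n∈ → successor (elem-view n n∈)
  }
  where
  open Triple z

  sum : ∀ {r q r′ q′} → P r q → P r′ q′ → r + q * 6 + (r′ + q′ * 6) ∈ Elem
  sum {q = q} {q′ = q′} zero zero =
    elem⁺ 0 (q + q′) (below-6 0) zero (residue-+ 0 0 q q′)
  sum {q = q} {q′ = q′} zero (three z≤q′) =
    elem⁺ 3 (q + q′) (below-6 3) (three (m≤n⇒m≤o+n q z≤q′)) (residue-+ 0 3 q q′)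
  sum {q = q} {q′ = q′} (three z≤q) zero =
    elem⁺ 3 (q + q′) (below-6 3) (three (m≤n⇒m≤n+o q′ z≤q)) (residue-+ 3 0 q q′)
  sum {q = q} {q′ = q′} (three _) (three _) =
    elem⁺ 0 (1 + q + q′) (below-6 0) zero (residue-+ 3 3 q q′)

  successor : ∀ {n} → ∃[ r ] ∃[ q ] n ≡ r + q * 6 × P r q → suc n ∉ Elem
  successor (0 , q , refl , zero)    1+n∈ with () ← elem⁻ 1 q (below-6 1) 1+n∈ refl
  successor (3 , q , refl , three _) 1+n∈ with () ← elem⁻ 4 q (below-6 4) 1+n∈ refl

-- Gaps of the truncated monoids.

index-below : ∀ (f : ℕ → ℕ) → (∀ n → f n < f (suc n)) → ∀ (M : Pred ℕ 0ℓ) {k c} →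
              f k ∉ M ∪≥ f c → k < c
index-below f step M f∉ = ≰⇒> (f∉ ∘ inj₂ ∘ increasing⇒≤ f step)

-- Under the two bounds the tail adds nothing to the classes 2 and 4, so `x` and `y` can be read off
-- from the truncation.
module EvenTail (x y s : ℕ) (x-visible : x * 3 ≤ s + 2) (y-visible : y * 3 ≤ s + 1) where
  open Even x y

  two∈⇒ : ∀ {q} → 2 + q * 6 ∈ Elem ∪≥ odd s → x ≤ q
  two∈⇒ {q} (inj₁ 2∈) with two x≤q ← elem⁻ 2 q (below-6 2) 2∈ refl = x≤q
  two∈⇒ {q} (inj₂ odd≤) =
    -- Here `6 x ≤ 2 s + 4` and `2 s ≤ 6 q + 1`, so `6 x ≤ 6 q + 5`, and rounding down gives the
    -- claim.
    linear 5 0 (+-mono-≤ (+-mono-≤ x-visible x-visible) odd≤) (certificate x s q)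
    where
    certificate : ∀ x s q → 6 * x + (s + 2 + (s + 2) + (2 + q * 6)) + 0 ≡
                            6 * q + (x * 3 + x * 3 + (1 + s * 2)) + 5
    certificate = solve-∀

  four∈⇒ : ∀ {q} → 4 + q * 6 ∈ Elem ∪≥ odd s → y ≤ q
  four∈⇒ {q} (inj₁ 4∈) with four y≤q ← elem⁻ 4 q (below-6 4) 4∈ refl = y≤q
  four∈⇒ {q} (inj₂ odd≤) =
    linear 5 0 (+-mono-≤ (+-mono-≤ y-visible y-visible) odd≤) (certificate y s q)
    where
    certificate : ∀ y s q → 6 * y + (s + 1 + (s + 1) + (4 + q * 6)) + 0 ≡
                            6 * q + (y * 3 + y * 3 + (1 + s * 2)) + 5
    certificate = solve-∀

  two∈ : ∀ {q} → x ≤ q → 2 + q * 6 ∈ Elem ∪≥ odd s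
  two∈ {q} x≤q = inj₁ (elem⁺ 2 q (below-6 2) (two x≤q) refl)

  four∈ : ∀ {q} → y ≤ q → 4 + q * 6 ∈ Elem ∪≥ odd s
  four∈ {q} y≤q = inj₁ (elem⁺ 4 q (below-6 4) (four y≤q) refl)

  gaps : Pred ℕ 0ℓ
  gaps = Image< odd s ∪ (Image< (λ q → 2 + q * 6) x ∪ Image< (λ q → 4 + q * 6) y)

  gaps≐ : gaps ≐ ∁ (Elem ∪≥ odd s)
  gaps≐ = gap⇒∉ , ∉⇒gap
    where
    gap⇒∉ : gaps ⊆ ∁ (Elem ∪≥ odd s)
    gap⇒∉ (inj₁ (i , i<s , refl)) (inj₁ odd∈) = odd∉ x y i odd∈
    gap⇒∉ (inj₁ (i , i<s , refl)) (inj₂ odd≤) = <⇒≱ (increasing⇒< odd odd-step i<s) odd≤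
    gap⇒∉ (inj₂ (inj₁ (q , q<x , refl))) 2∈   = <⇒≱ q<x (two∈⇒ 2∈)
    gap⇒∉ (inj₂ (inj₂ (q , q<y , refl))) 4∈   = <⇒≱ q<y (four∈⇒ 4∈)

    odd-gap : ∀ {n} k → n ≡ odd k → n ∉ Elem ∪≥ odd s → n ∈ gaps
    odd-gap k refl odd∉ = inj₁ (k , index-below odd odd-step Elem odd∉ , refl)

    ∉⇒gap : ∁ (Elem ∪≥ odd s) ⊆ gaps
    ∉⇒gap {n} n∉ with n divMod 6
    ... | result q fzero refl = contradiction (inj₁ (elem⁺ 0 q (below-6 0) zero refl)) n∉
    ... | result q (fsuc fzero) refl = odd-gap (q * 3) (sym (odd-period 0 q)) n∉
    ... | result q (fsuc (fsuc fzero)) refl =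
      inj₂ (inj₁ (q , ≰⇒> (n∉ ∘ two∈) , refl))
    ... | result q (fsuc (fsuc (fsuc fzero))) refl = odd-gap (1 + q * 3) (sym (odd-period 1 q)) n∉
    ... | result q (fsuc (fsuc (fsuc (fsuc fzero)))) refl =
      inj₂ (inj₂ (q , ≰⇒> (n∉ ∘ four∈) , refl))
    ... | result q (fsuc (fsuc (fsuc (fsuc (fsuc fzero))))) refl =
      odd-gap (2 + q * 3) (sym (odd-period 2 q)) n∉

  gaps-HasCardinality : HasCardinality (setoid ℕ) (∁ (Elem ∪≥ odd s)) (s + (x + y))
  gaps-HasCardinality = ≐-HasCardinality gaps≐
    (∪-HasCardinality odd-disjoint (Image<-HasCardinality odd odd-step s)
      (∪-HasCardinality two-disjoint (Image<-HasCardinality _ (residue-step 2) x)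
                                     (Image<-HasCardinality _ (residue-step 4) y)))
    where
    odd-disjoint : ∀ {n} → n ∈ Image< odd s → ¬ _
    -- With both coordinates 0 the pattern consists of all even numbers.
    odd-disjoint (i , _ , refl) (inj₁ (q , _ , eq)) =
      odd∉ 0 0 i (Even.elem⁺ 0 0 2 q (below-6 2) (two z≤n) eq)
    odd-disjoint (i , _ , refl) (inj₂ (q , _ , eq)) =
      odd∉ 0 0 i (Even.elem⁺ 0 0 4 q (below-6 4) (four z≤n) eq)

    two-disjoint : ∀ {n} → n ∈ Image< (λ q → 2 + q * 6) x → n ∉ Image< (λ q → 4 + q * 6) y
    two-disjoint (q , _ , refl) (q′ , _ , eq) with () ← residue-unique q q′ (below-6 2) (below-6 4) eq

-- The bound makes `4 + z * 6` a gap, although `3 + z * 6` is an element. This separates these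
-- truncations from the even ones, in which every odd element lies in the tail.
module TripleTail (z t : ℕ) (z-visible : 3 + z * 4 ≤ t) where
  open Triple z

  nonTriple≥ : 5 + z * 6 ≤ nonTriple t
  nonTriple≥ = subst (_≤ nonTriple t) (nonTriple-period 3 z)
    (increasing⇒≤ nonTriple nonTriple-step z-visible)

  three∈⇒ : ∀ {q} → 3 + q * 6 ∈ Elem ∪≥ nonTriple t → z ≤ q
  three∈⇒ {q} (inj₁ 3∈) with three z≤q ← elem⁻ 3 q (below-6 3) 3∈ refl = z≤q
  three∈⇒ {q} (inj₂ nonTriple≤) = linear 5 7 (≤-trans nonTriple≥ nonTriple≤) (certificate z q)
    where
    certificate : ∀ z q → 6 * z + (3 + q * 6) + 7 ≡ 6 * q + (5 + z * 6) + 5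
    certificate = solve-∀

  four∉ : 4 + z * 6 ∉ Elem ∪≥ nonTriple t
  four∉ (inj₁ 4∈) with () ← elem⁻ 4 z (below-6 4) 4∈ refl
  four∉ (inj₂ nonTriple≤) = <⇒≱ nonTriple≥ nonTriple≤

  three∈ : ∀ {q} → z ≤ q → 3 + q * 6 ∈ Elem ∪≥ nonTriple t
  three∈ {q} z≤q = inj₁ (elem⁺ 3 q (below-6 3) (three z≤q) refl)

  gaps : Pred ℕ 0ℓ
  gaps = Image< nonTriple t ∪ Image< (λ q → 3 + q * 6) z

  gaps≐ : gaps ≐ ∁ (Elem ∪≥ nonTriple t)
  gaps≐ = gap⇒∉ , ∉⇒gap
    where
    gap⇒∉ : gaps ⊆ ∁ (Elem ∪≥ nonTriple t)
    gap⇒∉ (inj₁ (i , i<t , refl)) (inj₁ nonTriple∈) = nonTriple∉ z i nonTriple∈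
    gap⇒∉ (inj₁ (i , i<t , refl)) (inj₂ nonTriple≤) =
      <⇒≱ (increasing⇒< nonTriple nonTriple-step i<t) nonTriple≤
    gap⇒∉ (inj₂ (q , q<z , refl)) 3∈ = <⇒≱ q<z (three∈⇒ 3∈)

    nonTriple-gap : ∀ {n} k → n ≡ nonTriple k → n ∉ Elem ∪≥ nonTriple t → n ∈ gaps
    nonTriple-gap k refl nonTriple∉ =
      inj₁ (k , index-below nonTriple nonTriple-step Elem nonTriple∉ , refl)

    ∉⇒gap : ∁ (Elem ∪≥ nonTriple t) ⊆ gaps
    ∉⇒gap {n} n∉ with n divMod 6
    ... | result q fzero refl = contradiction (inj₁ (elem⁺ 0 q (below-6 0) zero refl)) n∉
    ... | result q (fsuc fzero) refl = nonTriple-gap (q * 4) (sym (nonTriple-period 0 q)) n∉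
    ... | result q (fsuc (fsuc fzero)) refl = nonTriple-gap (1 + q * 4) (sym (nonTriple-period 1 q)) n∉
    ... | result q (fsuc (fsuc (fsuc fzero))) refl =
      inj₂ (q , ≰⇒> (n∉ ∘ three∈) , refl)
    ... | result q (fsuc (fsuc (fsuc (fsuc fzero)))) refl =
      nonTriple-gap (2 + q * 4) (sym (nonTriple-period 2 q)) n∉
    ... | result q (fsuc (fsuc (fsuc (fsuc (fsuc fzero))))) refl =
      nonTriple-gap (3 + q * 4) (sym (nonTriple-period 3 q)) n∉

  gaps-HasCardinality : HasCardinality (setoid ℕ) (∁ (Elem ∪≥ nonTriple t)) (t + z)
  gaps-HasCardinality = ≐-HasCardinality gaps≐
    (∪-HasCardinality disjoint (Image<-HasCardinality nonTriple nonTriple-step t)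
                               (Image<-HasCardinality _ (residue-step 3) z))
    where
    disjoint : ∀ {n} → n ∈ Image< nonTriple t → n ∉ Image< (λ q → 3 + q * 6) z
    disjoint (i , _ , refl) (q , _ , eq) =
      nonTriple∉ 0 i (Triple.elem⁺ 0 3 q (below-6 3) (three z≤n) eq)

-- Parametrisation of the even seeds by pairs.

-- Opaque, lest the normal forms of seeds contain those of ring solver proofs.
opaque
  i+j+i≤ : ∀ i j → i + j + i ≤ (i + j) * 2
  i+j+i≤ i j = linear 0 j {c = 0} z≤n (certificate i j)
    where
    certificate : ∀ i j → 1 * (i + j + i) + 0 + j ≡ 1 * ((i + j) * 2) + 0 + 0
    certificate = solve-∀

  i+j≤ : ∀ i j → i + j ≤ (i + j + i) * 2
  i+j≤ i j = linear 0 (i + i + i + j) {c = 0} z≤n (certificate i j)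
    where
    certificate : ∀ i j → 1 * (i + j) + 0 + (i + i + i + j) ≡ 1 * ((i + j + i) * 2) + 0 + 0
    certificate = solve-∀

-- The points `(i , 2 i)` and `(1 + 2 i , i)` on the lines `y = 2 x` and `x = 1 + 2 y`, shifted by
-- `(j , j)`. The seeds `lower` have `x ≤ y`, the seeds `upper` have `y < x`.
lower upper : ℕ × ℕ → EvenSeed
lower (i , j) = seed (i + j) (i + j + i) (i+j+i≤ i j) (m≤n⇒m≤1+n (i+j≤ i j))
upper (i , j) = seed (1 + (i + j + i)) (i + j) (m≤n⇒m≤o+n 2 (i+j≤ i j)) (s≤s (i+j+i≤ i j))

lower-injective : ∀ {p q} → lower p ≡ lower q → p ≡ q
lower-injective {i , j} {i′ , j′} eq = cong₂ _,_ i≡i′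
  (+-cancelˡ-≡ i j j′ (trans x≡ (cong (_+ j′) (sym i≡i′))))
  where
  x≡ : i + j ≡ i′ + j′
  x≡ = cong EvenSeed.x eq
  i≡i′ : i ≡ i′
  i≡i′ = +-cancelˡ-≡ (i + j) i i′ (trans (cong EvenSeed.y eq) (cong (_+ i′) (sym x≡)))

upper-injective : ∀ {p q} → upper p ≡ upper q → p ≡ q
upper-injective {i , j} {i′ , j′} eq = cong₂ _,_ i≡i′
  (+-cancelˡ-≡ i j j′ (trans y≡ (cong (_+ j′) (sym i≡i′))))
  where
  y≡ : i + j ≡ i′ + j′
  y≡ = cong EvenSeed.y eq
  i≡i′ : i ≡ i′
  i≡i′ = +-cancelˡ-≡ (i + j) i i′
    (trans (suc-injective (cong EvenSeed.x eq)) (cong (_+ i′) (sym y≡)))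

lower≢upper : ∀ p q → lower p ≢ upper q
lower≢upper (i , j) (i′ , j′) eq = <⇒≱ y<x x≤y
  where
  x≤y : EvenSeed.x (lower (i , j)) ≤ EvenSeed.y (lower (i , j))
  x≤y = m≤m+n (i + j) i
  y<x : EvenSeed.y (lower (i , j)) < EvenSeed.x (lower (i , j))
  y<x = subst (λ σ → EvenSeed.y σ < EvenSeed.x σ) (sym eq) (s≤s (m≤m+n (i′ + j′) i′))

evenSeeds : ℕ → List EvenSeed
evenSeeds n = map lower (pairs (6 + n)) ++ map upper (pairs (3 + n))

unique-evenSeeds : ∀ n → Unique (evenSeeds n)
unique-evenSeeds n = Unique.++⁺
  (Unique.map⁺ (λ {p} {q} → lower-injective {p} {q}) (unique-pairs (6 + n)))
  (Unique.map⁺ (λ {p} {q} → upper-injective {p} {q}) (unique-pairs (3 + n)))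
  λ (∈lower , ∈upper) → disjoint (∈-map⁻ lower ∈lower) (∈-map⁻ upper ∈upper)
  where
  disjoint : ∀ {σ} → ∃[ p ] p ∈ₗ pairs (6 + n) × σ ≡ lower p →
             ¬ (∃[ q ] q ∈ₗ pairs (3 + n) × σ ≡ upper q)
  disjoint (p , _ , refl) (q , _ , eq) = lower≢upper p q eq

-- The visibility conditions say that the largest gaps 2 + (x - 1) * 6 and
-- 4 + (y - 1) * 6 of their residue classes lie below odd s.
record EvenFits (g : ℕ) (σ : EvenSeed) : Set where
  open EvenSeed σ
  field
    s         : ℕ
    x>0       : 0 < x
    y>0       : 0 < y
    size      : s + (x + y) ≡ g
    x-visible : x * 3 ≤ s + 2
    y-visible : y * 3 ≤ s + 1

-- As `x ≤ y`, the binding condition is `y-visible`. With `x + y = 3 i + 2 j` and `s = g - (x + y)`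
-- it becomes `9 i + 5 j ≤ g + 1`.
lower-fits : ∀ n {p} → p ∈ₗ pairs (6 + n) → EvenFits (5 + n) (lower p)
lower-fits n {i , j} p∈ = record
  { s         = s
  ; x>0       = positive
  ; y>0       = ≤-trans positive (m≤m+n (i + j) i)
  ; size      = size
  ; x-visible = linear 0 (1 + i * 3) bounded′ (x-certificate i j s)
  ; y-visible = linear 0 0 bounded′ (y-certificate i j s)
  }
  where
  positive : 1 ≤ i + j
  positive = proj₁ (∈-pairs⁻ (6 + n) p∈)
  bounded : i * 9 + j * 5 ≤ 6 + n
  bounded = proj₂ (∈-pairs⁻ (6 + n) p∈)

  s = 5 + n ∸ (i + j + (i + j + i))

  size-certificate : ∀ i j n → 1 * (i + j + (i + j + i)) + (i + j + (6 + n)) + (i * 5 + j * 2) ≡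
                               1 * (5 + n) + (1 + (i * 9 + j * 5)) + 0
  size-certificate = solve-∀

  size : s + (i + j + (i + j + i)) ≡ 5 + n
  size = m∸n+n≡m {5 + n} {i + j + (i + j + i)}
    -- The bound on the pair exceeds `5 + n` by one; `positive` makes up for it.
    (linear 0 (i * 5 + j * 2) (+-mono-≤ positive bounded) (size-certificate i j n))

  bounded′ : i * 9 + j * 5 ≤ 1 + (s + (i + j + (i + j + i)))
  bounded′ = subst (λ g → i * 9 + j * 5 ≤ 1 + g) (sym size) bounded

  x-certificate : ∀ i j s → 1 * ((i + j) * 3) + (1 + (s + (i + j + (i + j + i)))) + (1 + i * 3) ≡
                            1 * (s + 2) + (i * 9 + j * 5) + 0
  x-certificate = solve-∀
  y-certificate : ∀ i j s → 1 * ((i + j + i) * 3) + (1 + (s + (i + j + (i + j + i)))) + 0 ≡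
                            1 * (s + 1) + (i * 9 + j * 5) + 0
  y-certificate = solve-∀

-- As `y < x`, the binding condition is `x-visible`. With `x + y = 1 + 3 i + 2 j` it becomes
-- `9 i + 5 j ≤ g - 2`.
upper-fits : ∀ n {p} → p ∈ₗ pairs (3 + n) → EvenFits (5 + n) (upper p)
upper-fits n {i , j} p∈ = record
  { s         = s
  ; x>0       = s≤s z≤n
  ; y>0       = positive
  ; size      = size
  ; x-visible = linear 0 0 bounded′ (x-certificate i j s)
  ; y-visible = linear 0 (2 + i * 3) bounded′ (y-certificate i j s)
  }
  where
  positive : 1 ≤ i + j
  positive = proj₁ (∈-pairs⁻ (3 + n) p∈)
  bounded : i * 9 + j * 5 ≤ 3 + n
  bounded = proj₂ (∈-pairs⁻ (3 + n) p∈)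

  s = 5 + n ∸ (1 + (i + j + i) + (i + j))

  size-certificate : ∀ i j n → 1 * (1 + (i + j + i) + (i + j)) + (3 + n) + (1 + i * 6 + j * 3) ≡
                               1 * (5 + n) + (i * 9 + j * 5) + 0
  size-certificate = solve-∀

  size : s + (1 + (i + j + i) + (i + j)) ≡ 5 + n
  size = m∸n+n≡m {5 + n} {1 + (i + j + i) + (i + j)}
    (linear 0 (1 + i * 6 + j * 3) bounded (size-certificate i j n))

  bounded′ : 2 + (i * 9 + j * 5) ≤ s + (1 + (i + j + i) + (i + j))
  bounded′ = subst (2 + (i * 9 + j * 5) ≤_) (sym size) (+-monoʳ-≤ 2 bounded)

  x-certificate : ∀ i j s → 1 * ((1 + (i + j + i)) * 3) + (s + (1 + (i + j + i) + (i + j))) + 0 ≡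
                            1 * (s + 2) + (2 + (i * 9 + j * 5)) + 0
  x-certificate = solve-∀
  y-certificate : ∀ i j s → 1 * ((i + j) * 3) + (s + (1 + (i + j + i) + (i + j))) + (2 + i * 3) ≡
                            1 * (s + 1) + (2 + (i * 9 + j * 5)) + 0
  y-certificate = solve-∀

evenSeeds-fit : ∀ n {σ} → σ ∈ₗ evenSeeds n → EvenFits (5 + n) σ
evenSeeds-fit n σ∈ with ∈-++⁻ (map lower (pairs (6 + n))) σ∈
... | inj₁ ∈lower with p , p∈ , refl ← ∈-map⁻ lower ∈lower = lower-fits n {p} p∈
... | inj₂ ∈upper with p , p∈ , refl ← ∈-map⁻ upper ∈upper = upper-fits n {p} p∈

lower-fits⇒∈pairs : ∀ n i j → EvenFits (5 + n) (lower (i , j)) → (i , j) ∈ₗ pairs (6 + n)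
lower-fits⇒∈pairs n i j fits = ∈-pairs⁺ (6 + n) x>0
  (subst (λ g → i * 9 + j * 5 ≤ 1 + g) size (linear 0 0 y-visible (certificate i j s)))
  where
  open EvenFits fits
  certificate : ∀ i j s → 1 * (i * 9 + j * 5) + (s + 1) + 0 ≡
                          1 * (1 + (s + (i + j + (i + j + i)))) + (i + j + i) * 3 + 0
  certificate = solve-∀

upper-fits⇒∈pairs : ∀ n i j → EvenFits (5 + n) (upper (i , j)) → (i , j) ∈ₗ pairs (3 + n)
upper-fits⇒∈pairs n i j fits = ∈-pairs⁺ (3 + n) y>0
  (+-cancelˡ-≤ 2 _ _ (subst (2 + (i * 9 + j * 5) ≤_) size (linear 0 0 x-visible (certificate i j s))))
  where
  open EvenFits fits
  certificate : ∀ i j s → 1 * (2 + (i * 9 + j * 5)) + (s + 2) + 0 ≡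
                          1 * (s + (1 + (i + j + i) + (i + j))) + (1 + (i + j + i)) * 3 + 0
  certificate = solve-∀

double : ∀ n → n * 2 ≡ n + n
double = solve-∀

-- Take `i = y - x` if `x ≤ y` and `i = x - y - 1` otherwise. The inequality of the seed bounds `i`
-- by the smaller coordinate, and `j` is the difference.
fits⇒∈evenSeeds : ∀ n σ → EvenFits (5 + n) σ → σ ∈ₗ evenSeeds n
fits⇒∈evenSeeds n (seed x y y≤ x≤) fits with <-≤-connex y x
... | inj₂ x≤y
  with i , refl ← m≤n⇒∃[o]m+o≡n x≤y
  with j , refl ← m≤n⇒∃[o]m+o≡n
         {i} (+-cancelˡ-≤ x i x (subst (x + i ≤_) (double x) (recompute (x + i ≤? x * 2) y≤)))
  = ∈-++⁺ˡ (∈-map⁺ lower (lower-fits⇒∈pairs n i j fits))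
... | inj₁ y<x
  with i , refl ← m≤n⇒∃[o]m+o≡n y<x
  with j , refl ← m≤n⇒∃[o]m+o≡n
         {i} (+-cancelˡ-≤ y i y (subst (y + i ≤_) (double y)
               (s≤s⁻¹ (recompute (suc (y + i) ≤? 1 + y * 2) x≤))))
  = ∈-++⁺ʳ (map lower (pairs (6 + n))) (∈-map⁺ upper (upper-fits⇒∈pairs n i j fits))

-- The listed semigroups: genus, multiplicity and distinctness.

evenSemigroup : ℕ → EvenSeed → NumericalSemigroup
evenSemigroup g σ = SparseMonoid.truncation (evenMonoid σ) (odd (g ∸ (x + y)))
  where open EvenSeed σ

tripleSemigroup : ℕ → ℕ → NumericalSemigroup
tripleSemigroup g z = SparseMonoid.truncation (tripleMonoid z) (nonTriple (g ∸ z))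

Counted : ℕ → NumericalSemigroup → Set₁
Counted g Λ = genus Λ ≡ g × IsMultiplicity Λ 6 × InInfiniteChain Λ

module EvenSound {g : ℕ} (g≥5 : 5 ≤ g) {x y} .{y≤ : y ≤ x * 2} .{x≤ : x ≤ 1 + y * 2}
                 (fits : EvenFits g (seed x y y≤ x≤)) where
  open EvenFits fits
  open Even x y
  open EvenTail x y s x-visible y-visible public

  semigroup≐ : Member (evenSemigroup g (seed x y y≤ x≤)) ≐ Elem ∪≥ odd s
  semigroup≐ = subst (λ s → Member (evenSemigroup g (seed x y y≤ x≤)) ≐ Elem ∪≥ odd s)
    (trans (cong (_∸ (x + y)) (sym size)) (m+n∸n≡m s (x + y)))
    (SparseMonoid.truncation≐ (evenMonoid (seed x y y≤ x≤)) (odd (g ∸ (x + y))))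

  -- Adding the visibility bounds gives `3 (x + y) ≤ 2 s + 3`, so `15 ≤ 3 g ≤ 5 s + 3`. This puts
  -- the tail beyond 6.
  s≥3 : 3 ≤ s
  s≥3 = linear 4 1 (+-mono-≤ (+-mono-≤ x-visible y-visible) (*-monoˡ-≤ 3 (subst (5 ≤_) (sym size) g≥5)))
    (certificate x y s)
    where
    certificate : ∀ x y s → 5 * 3 + (s + 2 + (s + 1) + (s + (x + y)) * 3) + 1 ≡
                            5 * s + (x * 3 + y * 3 + 5 * 3) + 4
    certificate = solve-∀

  odd≥6 : 6 ≤ odd s
  odd≥6 = ≤-trans (n≤1+n 6) (s≤s (*-monoˡ-≤ 2 s≥3))

  counted : ∀ Λ → Member Λ ≐ Member (evenSemigroup g (seed x y y≤ x≤)) → Counted g Λ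
  counted Λ Λ≐ =
    trans (≐-genus Λ (≐-trans Λ≐ semigroup≐) gaps-HasCardinality) size ,
    multiplicity (λ { (two x≤0) → <⇒≱ x>0 x≤0 ; (four y≤0) → <⇒≱ y>0 y≤0 })
      Λ (≐-trans Λ≐ semigroup≐) odd≥6 ,
    SparseMonoid.truncation-inChain (evenMonoid (seed x y y≤ x≤)) (odd (g ∸ (x + y))) Λ Λ≐

even-injective : ∀ {g} → 5 ≤ g → ∀ {σ τ} → EvenFits g σ → EvenFits g τ →
                 Member (evenSemigroup g σ) ≐ Member (evenSemigroup g τ) → σ ≡ τ
even-injective g≥5 {seed x y _ _} {seed x′ y′ _ _} σ-fits τ-fits (to , from) = seed-cong
  (≤-antisym (S.two∈⇒ (T⇒S (T.two∈ ≤-refl))) (T.two∈⇒ (S⇒T (S.two∈ ≤-refl))))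
  (≤-antisym (S.four∈⇒ (T⇒S (T.four∈ ≤-refl))) (T.four∈⇒ (S⇒T (S.four∈ ≤-refl))))
  where
  module S = EvenSound g≥5 σ-fits
  module T = EvenSound g≥5 τ-fits

  S⇒T : Even.Elem x y ∪≥ odd (EvenFits.s σ-fits) ⊆ Even.Elem x′ y′ ∪≥ odd (EvenFits.s τ-fits)
  S⇒T = proj₁ T.semigroup≐ ∘ to ∘ proj₂ S.semigroup≐

  T⇒S : Even.Elem x′ y′ ∪≥ odd (EvenFits.s τ-fits) ⊆ Even.Elem x y ∪≥ odd (EvenFits.s σ-fits)
  T⇒S = proj₁ S.semigroup≐ ∘ from ∘ proj₂ T.semigroup≐

  seed-cong : ∀ {x y x′ y′} .{p q p′ q′} → x ≡ x′ → y ≡ y′ → seed x y p q ≡ seed x′ y′ p′ q′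
  seed-cong refl refl = refl

record TripleFits (g z : ℕ) : Set where
  field
    t         : ℕ
    z>0       : 0 < z
    size      : t + z ≡ g
    z-visible : 3 + z * 4 ≤ t

module TripleSound {g z} (fits : TripleFits g z) where
  open TripleFits fits
  open Triple z
  open TripleTail z t z-visible public

  semigroup≐ : Member (tripleSemigroup g z) ≐ Elem ∪≥ nonTriple t
  semigroup≐ = subst (λ t → Member (tripleSemigroup g z) ≐ Elem ∪≥ nonTriple t)
    (trans (cong (_∸ z) (sym size)) (m+n∸n≡m t z))
    (SparseMonoid.truncation≐ (tripleMonoid z) (nonTriple (g ∸ z)))

  nonTriple≥6 : 6 ≤ nonTriple t
  nonTriple≥6 = ≤-trans (≤-trans (*-monoˡ-≤ 6 z>0) (m≤n+m (z * 6) 5)) nonTriple≥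

  counted : ∀ Λ → Member Λ ≐ Member (tripleSemigroup g z) → Counted g Λ
  counted Λ Λ≐ =
    trans (≐-genus Λ (≐-trans Λ≐ semigroup≐) gaps-HasCardinality) size ,
    multiplicity (λ { (three z≤0) → <⇒≱ z>0 z≤0 }) Λ (≐-trans Λ≐ semigroup≐) nonTriple≥6 ,
    SparseMonoid.truncation-inChain (tripleMonoid z) (nonTriple (g ∸ z)) Λ Λ≐

triple-injective : ∀ {g z z′} → TripleFits g z → TripleFits g z′ →
                   Member (tripleSemigroup g z) ≐ Member (tripleSemigroup g z′) → z ≡ z′
triple-injective fits fits′ (to , from) = ≤-antisym
  (S.three∈⇒ (proj₁ S.semigroup≐ (from (proj₂ T.semigroup≐ (T.three∈ ≤-refl)))))
  (T.three∈⇒ (proj₁ T.semigroup≐ (to (proj₂ S.semigroup≐ (S.three∈ ≤-refl)))))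
  where
  module S = TripleSound fits
  module T = TripleSound fits′

-- In the even case the successors of an odd element are elements.
even≄triple : ∀ {g} → 5 ≤ g → ∀ {σ z} → EvenFits g σ → TripleFits g z →
              ¬ (Member (evenSemigroup g σ) ≐ Member (tripleSemigroup g z))
even≄triple g≥5 {seed x y _ _} {z} σ-fits z-fits (to , from) =
  case proj₁ S.semigroup≐ (from (proj₂ T.semigroup≐ (T.three∈ ≤-refl))) of λ where
    (inj₁ 3∈)   → case Even.elem⁻ x y 3 z (below-6 3) 3∈ refl of λ ()
    (inj₂ odd≤) → T.four∉ (proj₁ T.semigroup≐ (to (proj₂ S.semigroup≐ (inj₂ (m≤n⇒m≤1+n odd≤)))))
  where
  module S = EvenSound g≥5 σ-fits
  module T = TripleSound z-fits

-- For `t = g - z` the bound `3 + z * 4 ≤ t` reads `5 z ≤ g - 3`; the shift `z = suc i` excludes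
-- `z = 0`.
tripleFits⁺ : ∀ n {i} → i < (2 + n) / 5 → TripleFits (5 + n) (suc i)
tripleFits⁺ n {i} i< = record
  { t         = 5 + n ∸ suc i
  ; z>0       = s≤s z≤n
  ; size      = size
  ; z-visible = linear 0 0 (subst (3 + suc i * 5 ≤_) (sym size) bounded) (certificate i (5 + n ∸ suc i))
  }
  where
  bounded : 3 + suc i * 5 ≤ 5 + n
  bounded = +-monoʳ-≤ 3 (≤/⇒*≤ 5 i<)

  size : 5 + n ∸ suc i + suc i ≡ 5 + n
  size = m∸n+n≡m {5 + n} {suc i} (≤-trans (≤-trans (m≤m*n (suc i) 5) (m≤n+m (suc i * 5) 3)) bounded)

  certificate : ∀ i t → 1 * (3 + (1 + i) * 4) + (t + (1 + i)) + 0 ≡ 1 * t + (3 + (1 + i) * 5) + 0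
  certificate = solve-∀

tripleFits⁻ : ∀ n {i} → TripleFits (5 + n) (suc i) → i < (2 + n) / 5
tripleFits⁻ n {i} fits = *≤⇒≤/ 5 (+-cancelˡ-≤ 3 _ _
  (subst (3 + suc i * 5 ≤_) size (linear 0 0 z-visible (certificate i t))))
  where
  open TripleFits fits
  certificate : ∀ i t → 1 * (3 + (1 + i) * 5) + t + 0 ≡ 1 * (t + (1 + i)) + (3 + (1 + i) * 4) + 0
  certificate = solve-∀

-- Classification of the semigroups in infinite chains.

module Classification (n : ℕ) (Λ : NumericalSemigroup) (counted : Counted (5 + n) Λ) where
  open NumericalSemigroup Λ using (member?; +-closed)

  private
    C = proj₁ (proj₂ (proj₂ counted))
    i = proj₁ (proj₂ (proj₂ (proj₂ counted)))
    Λ≐term = proj₂ (proj₂ (proj₂ (proj₂ counted)))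

    c : ℕ
    c = conductor C i

    above-c : ∀ m → c ≤ m → m ∈ Member Λ
    above-c m c≤m = proj₂ Λ≐term (above-conductor C i m c≤m)

    6∈ : 6 ∈ Member Λ
    6∈ = proj₁ (proj₁ (proj₁ (proj₂ counted)))

    ≥6 : ∀ {m} → suc m ∈ Member Λ → 6 ≤ suc m
    ≥6 m∈ = proj₂ (proj₁ (proj₂ counted)) _ (m∈ , λ ())

    least-in : ∀ r → ∃[ x ] IsLeast (λ q → r + q * 6 ∈ Member Λ) x
    least-in r = least (λ q → member? (r + q * 6)) c
      (above-c _ (≤-trans (m≤m*n c 6) (m≤n+m (c * 6) r)))

    least-positive : ∀ r {r<6 : True (suc r <? 6)} {x} →
                     IsLeast (λ q → suc r + q * 6 ∈ Member Λ) x → 0 < x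
    least-positive r {r<6} {zero} (r∈ , _) =
      contradiction (≥6 r∈) (<⇒≱ (subst (_< 6) (sym (+-identityʳ (suc r))) (toWitness r<6)))
    least-positive r {x = suc x} _ = s≤s z≤n

    -- The number 6 below the least element of a residue class is a gap, hence smaller than `b`.
    least-below : ∀ r {x b} → IsLeast (λ q → suc r + q * 6 ∈ Member Λ) x → 0 < x →
                  (∀ m → b ≤ m → m ∈ Member Λ) → suc r + x * 6 < 6 + b
    least-below r {suc x} {b} (_ , minimal) _ above-b =
      subst (_< 6 + b) (regroup r x) (+-monoʳ-< 6 (≰⇒> λ b≤ → 1+n≰n (minimal x (above-b _ b≤))))
      where
      regroup : ∀ r x → 6 + (1 + r + x * 6) ≡ 1 + r + (1 + x) * 6
      regroup = solve-∀

    oddLeast : ∃[ s ] IsLeast (λ k → odd k ∈ Member Λ) s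
    oddLeast = least (λ k → member? (odd k)) c (above-c _ (m≤n⇒m≤1+n (m≤m*n c 2)))

    s = proj₁ oddLeast
    odd∈ = proj₁ (proj₂ oddLeast)

    tripleLeast : ∃[ t ] IsLeast (λ k → nonTriple k ∈ Member Λ) t
    tripleLeast = least (λ k → member? (nonTriple k)) c (above-c _ (≤nonTriple c))

    t = proj₁ tripleLeast
    nonTriple∈ = proj₁ (proj₂ tripleLeast)

    residue∈ : ∀ r {q q′} → q ≤ q′ → r + q * 6 ∈ Member Λ → r + q′ * 6 ∈ Member Λ
    residue∈ r = same-residue Λ 6∈ r

  even-case : (∀ m → odd s ≤ m → m ∈ Member Λ) →
              ∃[ σ ] EvenFits (5 + n) σ × Member Λ ≐ Member (evenSemigroup (5 + n) σ)
  even-case above-odd = σ , fits , ≐-trans Λ≐ (≐-sym (EvenSound.semigroup≐ (m≤m+n 5 n) fits))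
    where
    x = proj₁ (least-in 2)
    y = proj₁ (least-in 4)
    x-least = proj₂ (least-in 2)
    y-least = proj₂ (least-in 4)
    2∈ = proj₁ x-least
    4∈ = proj₁ y-least
    open Even x y

    σ : EvenSeed
    -- The double of the least element of either class lies in the other class, so minimality there
    -- gives the inequalities.
    σ = seed x y
      (proj₂ y-least _ (subst (Member Λ) (regroup x) (+-closed 2∈ 2∈)))
      (proj₂ x-least _ (subst (Member Λ) (regroup′ y) (+-closed 4∈ 4∈)))
      where
      regroup : ∀ x → 2 + x * 6 + (2 + x * 6) ≡ 4 + x * 2 * 6
      regroup = solve-∀
      regroup′ : ∀ y → 4 + y * 6 + (4 + y * 6) ≡ 2 + (1 + y * 2) * 6
      regroup′ = solve-∀

    Λ≐ : Member Λ ≐ Elem ∪≥ odd s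
    Λ≐ = to , [ from , above-odd _ ]′
      where
      odd-above : ∀ {m} k → m ≡ odd k → m ∈ Member Λ → m ∈ Elem ∪≥ odd s
      odd-above k refl m∈ = inj₂ (increasing⇒≤ odd odd-step (proj₂ (proj₂ oddLeast) k m∈))

      to : ∀ {m} → m ∈ Member Λ → m ∈ Elem ∪≥ odd s
      to {m} m∈ with m divMod 6
      ... | result q fzero refl = inj₁ (elem⁺ 0 q (below-6 0) zero refl)
      ... | result q (fsuc fzero) refl = odd-above (q * 3) (sym (odd-period 0 q)) m∈
      ... | result q (fsuc (fsuc fzero)) refl =
        inj₁ (elem⁺ 2 q (below-6 2) (two (proj₂ x-least q m∈)) refl)
      ... | result q (fsuc (fsuc (fsuc fzero))) refl = odd-above (1 + q * 3) (sym (odd-period 1 q)) m∈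
      ... | result q (fsuc (fsuc (fsuc (fsuc fzero)))) refl =
        inj₁ (elem⁺ 4 q (below-6 4) (four (proj₂ y-least q m∈)) refl)
      ... | result q (fsuc (fsuc (fsuc (fsuc (fsuc fzero))))) refl =
        odd-above (2 + q * 3) (sym (odd-period 2 q)) m∈

      from : ∀ {m} → m ∈ Elem → m ∈ Member Λ
      from {m} m∈ with elem-view m m∈
      ... | _ , q , refl , zero     = multiple-of-6 Λ 6∈ q
      ... | _ , q , refl , two x≤q  = residue∈ 2 x≤q 2∈
      ... | _ , q , refl , four y≤q = residue∈ 4 y≤q 4∈

    x-visible : x * 3 ≤ s + 2
    x-visible = linear 1 1 (least-below 1 x-least (least-positive 1 x-least) above-odd) (certificate x s)
      where
      certificate : ∀ x s → 2 * (x * 3) + (6 + (1 + s * 2)) + 1 ≡ 2 * (s + 2) + (3 + x * 6) + 1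
      certificate = solve-∀

    y-visible : y * 3 ≤ s + 1
    y-visible = linear 1 1 (least-below 3 y-least (least-positive 3 y-least) above-odd) (certificate y s)
      where
      certificate : ∀ y s → 2 * (y * 3) + (6 + (1 + s * 2)) + 1 ≡ 2 * (s + 1) + (5 + y * 6) + 1
      certificate = solve-∀

    fits : EvenFits (5 + n) σ
    fits = record
      { s         = s
      ; x>0       = least-positive 1 x-least
      ; y>0       = least-positive 3 y-least
      ; size      = trans (sym (≐-genus Λ Λ≐ (EvenTail.gaps-HasCardinality x y s x-visible y-visible)))
                          (proj₁ counted)
      ; x-visible = x-visible
      ; y-visible = y-visible
      }

  -- If the tail contains `4 + z * 6`, the least odd element either lies in the tail or is at least
  -- `3 + z * 6`. In both cases everything after it belongs to `Λ`, which is the even case.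
  triple-case : (∀ m → nonTriple t ≤ m → m ∈ Member Λ) →
                (∀ m → odd s ≤ m → m ∈ Member Λ) ⊎
                ∃[ z ] TripleFits (5 + n) z × Member Λ ≐ Member (tripleSemigroup (5 + n) z)
  triple-case above-nonTriple = case 3 + z * 4 ≤? t of λ where
      (yes z-visible) → inj₂ (z , fits z-visible ,
        ≐-trans Λ≐ (≐-sym (TripleSound.semigroup≐ (fits z-visible))))
      (no z-hidden)   → inj₁ (above-odd (s≤s⁻¹ (≰⇒> z-hidden)) (proj₁ Λ≐ odd∈))
    where
    z = proj₁ (least-in 3)
    z-least = proj₂ (least-in 3)
    open Triple z

    Λ≐ : Member Λ ≐ Elem ∪≥ nonTriple t
    Λ≐ = to , [ from , above-nonTriple _ ]′
      where
      nonTriple-above : ∀ {m} k → m ≡ nonTriple k → m ∈ Member Λ → m ∈ Elem ∪≥ nonTriple t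
      nonTriple-above k refl m∈ =
        inj₂ (increasing⇒≤ nonTriple nonTriple-step (proj₂ (proj₂ tripleLeast) k m∈))

      to : ∀ {m} → m ∈ Member Λ → m ∈ Elem ∪≥ nonTriple t
      to {m} m∈ with m divMod 6
      ... | result q fzero refl = inj₁ (elem⁺ 0 q (below-6 0) zero refl)
      ... | result q (fsuc fzero) refl = nonTriple-above (q * 4) (sym (nonTriple-period 0 q)) m∈
      ... | result q (fsuc (fsuc fzero)) refl = nonTriple-above (1 + q * 4) (sym (nonTriple-period 1 q)) m∈
      ... | result q (fsuc (fsuc (fsuc fzero))) refl =
        inj₁ (elem⁺ 3 q (below-6 3) (three (proj₂ z-least q m∈)) refl)
      ... | result q (fsuc (fsuc (fsuc (fsuc fzero)))) refl =
        nonTriple-above (2 + q * 4) (sym (nonTriple-period 2 q)) m∈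
      ... | result q (fsuc (fsuc (fsuc (fsuc (fsuc fzero))))) refl =
        nonTriple-above (3 + q * 4) (sym (nonTriple-period 3 q)) m∈

      from : ∀ {m} → m ∈ Elem → m ∈ Member Λ
      from {m} m∈ with elem-view m m∈
      ... | _ , q , refl , zero      = multiple-of-6 Λ 6∈ q
      ... | _ , q , refl , three z≤q = residue∈ 3 z≤q (proj₁ z-least)

    fits : 3 + z * 4 ≤ t → TripleFits (5 + n) z
    fits z-visible = record
      { t         = t
      ; z>0       = least-positive 2 z-least
      ; size      = trans (sym (≐-genus Λ Λ≐ (TripleTail.gaps-HasCardinality z t z-visible)))
                          (proj₁ counted)
      ; z-visible = z-visible
      }

    above-odd : t ≤ 2 + z * 4 → odd s ∈ Elem ∪≥ nonTriple t → ∀ m → odd s ≤ m → m ∈ Member Λ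
    above-odd z-hidden (inj₂ nonTriple≤) m odd≤m = above-nonTriple m (≤-trans nonTriple≤ odd≤m)
    above-odd z-hidden (inj₁ odd∈M) m odd≤m with m≤n⇒m<n∨m≡n odd≤m
    ... | inj₂ refl  = odd∈
    ... | inj₁ odd<m with elem-view (odd s) odd∈M
    ...   | _ , q , eq , zero      =
      contradiction (Even.elem⁺ 0 0 0 q (below-6 0) zero eq) (odd∉ 0 0 s)
    ...   | _ , q , eq , three z≤q = above-nonTriple m (begin
      nonTriple t            ≤⟨ increasing⇒≤ nonTriple nonTriple-step z-hidden ⟩
      nonTriple (2 + z * 4)  ≡⟨ nonTriple-period 2 z ⟩
      4 + z * 6              ≤⟨ +-monoʳ-≤ 4 (*-monoˡ-≤ 6 z≤q) ⟩
      4 + q * 6              ≡⟨ cong suc eq ⟨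
      suc (odd s)            ≤⟨ odd<m ⟩
      m                      ∎)
      where open ≤-Reasoning

  -- The dichotomy is applied to the least odd element and the least non-multiple of 3: from one of
  -- them on, everything belongs to `Λ`.
  classification : (∃[ σ ] EvenFits (5 + n) σ × Member Λ ≐ Member (evenSemigroup (5 + n) σ)) ⊎
                   (∃[ z ] TripleFits (5 + n) z × Member Λ ≐ Member (tripleSemigroup (5 + n) z))
  classification with chain-dichotomy C i s t (≥6 odd∈)
    (proj₁ Λ≐term 6∈) (proj₁ Λ≐term odd∈) (proj₁ Λ≐term nonTriple∈)
  ... | inj₁ c≤odd       = inj₁ (even-case λ m odd≤m → above-c m (≤-trans c≤odd odd≤m))
  ... | inj₂ c≤nonTriple with triple-case (λ m nonTriple≤m → above-c m (≤-trans c≤nonTriple nonTriple≤m))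
  ...   | inj₁ above-odd = inj₁ (even-case above-odd)
  ...   | inj₂ triple    = inj₂ triple

-- The complete list and its length.

AllPairs-weaken : ∀ {a p r s} {A : Set a} {P : Pred A p} {R : A → A → Set r} {S : A → A → Set s} →
                  (∀ {x y} → P x → P y → R x y → S x y) →
                  ∀ {xs} → All P xs → AllPairs R xs → AllPairs S xs
AllPairs-weaken R⇒S All.[] AllPairs.[] = AllPairs.[]
AllPairs-weaken R⇒S (px All.∷ pxs) (rx AllPairs.∷ rxs) =
  All.zipWith (uncurry (R⇒S px)) (pxs , rx) AllPairs.∷ AllPairs-weaken R⇒S pxs rxs

theorem5p12 : ∀ (g : ℕ) → g ≥ 5 →
    HasCardinality numericalSemigroups
    (λ Λ → genus Λ ≡ g × IsMultiplicity Λ 6 × InInfiniteChain Λ)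
    ((2 * g ^ 2 + g ∸ 16) / 9 ∸ (g ∸ 1) ^ 2 / 5)
theorem5p12 (suc (suc (suc (suc (suc n))))) g≥5@(s≤s (s≤s (s≤s (s≤s (s≤s z≤n))))) = record
  { elements = evens ++ triples
  ; unique   = AllPairs.++⁺
      -- Injectivity is available for seeds that fit, so the fit of all entries is carried along.
      (AllPairs.map⁺ (AllPairs-weaken
        (λ σ-fits τ-fits σ≢τ → σ≢τ ∘ even-injective g≥5 σ-fits τ-fits)
        (All.tabulate (evenSeeds-fit n)) (unique-evenSeeds n)))
      (AllPairs.applyUpTo⁺₁ triple ((2 + n) / 5) λ i<j j< eq →
        <⇒≢ i<j (suc-injective (triple-injective (tripleFits⁺ n (<-trans i<j j<)) (tripleFits⁺ n j<) eq)))
      (All.map⁺ (All.tabulate λ σ∈ → All.applyUpTo⁺₁ triple ((2 + n) / 5) λ i< →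
        even≄triple g≥5 (evenSeeds-fit n σ∈) (tripleFits⁺ n i<)))
  ; complete = λ Λ → mk⇔ (sound Λ) (complete Λ)
  ; size     = begin
      length (evens ++ triples)
        ≡⟨ length-++ evens ⟩
      length evens + length triples
        ≡⟨ cong₂ _+_ (trans (length-map (evenSemigroup g) (evenSeeds n)) length-evenSeeds)
                     (length-applyUpTo triple ((2 + n) / 5)) ⟩
      count n
        ≡⟨ count-formula n ⟩
      (2 * g ^ 2 + g ∸ 16) / 9 ∸ (4 + n) ^ 2 / 5 ∎
  }
  where
  open ≡-Reasoning
  g = 5 + n

  triple : ℕ → NumericalSemigroup
  triple i = tripleSemigroup g (suc i)

  evens triples : List NumericalSemigroup
  evens   = map (evenSemigroup g) (evenSeeds n)
  triples = applyUpTo triple ((2 + n) / 5)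

  length-evenSeeds : length (evenSeeds n) ≡ length (pairs (6 + n)) + length (pairs (3 + n))
  length-evenSeeds = trans (length-++ (map lower (pairs (6 + n))))
    (cong₂ _+_ (length-map lower (pairs (6 + n))) (length-map upper (pairs (3 + n))))

  open Membership numericalSemigroups using () renaming (_∈_ to _∈ₛ_)

  sound : ∀ Λ → Λ ∈ₛ (evens ++ triples) → Counted g Λ
  sound Λ Λ∈ with Any.++⁻ evens Λ∈
  ... | inj₁ Λ∈evens with σ , σ∈ , Λ≐ ← find (Any.map⁻ Λ∈evens) =
    EvenSound.counted g≥5 (evenSeeds-fit n σ∈) Λ Λ≐
  ... | inj₂ Λ∈triples with i , i< , Λ≐ ← Any.applyUpTo⁻ triple Λ∈triples =
    TripleSound.counted (tripleFits⁺ n i<) Λ Λ≐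

  complete : ∀ Λ → Counted g Λ → Λ ∈ₛ (evens ++ triples)
  complete Λ counted with Classification.classification n Λ counted
  ... | inj₁ (σ , fits , Λ≐) = Any.++⁺ˡ (Any.map⁺ (lose (fits⇒∈evenSeeds n σ fits) Λ≐))
  ... | inj₂ (zero , fits , _) = contradiction (TripleFits.z>0 fits) λ ()
  ... | inj₂ (suc i , fits , Λ≐) =
    Any.++⁺ʳ evens (Any.applyUpTo⁺ triple Λ≐ (tripleFits⁻ n fits))
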